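{- Let $V$ be a finite set (case $q=1$) or a finite-dimensional $\mathbb{F}_q$-vector space (case $q\ge 2$ a prime power), $n=\operatorname{rk}V$. For all $k\in\{0,\ldots,n\}$ and all $i\in\{0,\ldots,\min(k,n-k)\}$, $$(\bar V_i^{(k)})^\perp=\bar V_i^{(n-k)} ,$$ where $(\bar V_i^{(k)})^\perp=\{f^\perp\mid f\in\bar V_i^{(k)}\}$ is the set of dualized functions. In other words, $\deg(f^\perp)=\deg(f)$ for all $f:{V\brack k}\to\mathbb{R}$.
   Context: For $q=1$, "subspaces" of $V$ are subsets and $\operatorname{rk}U=\#U$; for $q\ge2$ they are $\mathbb{F}_q$-linear subspaces and $\operatorname{rk}U=\dim U$. $U\le W$ means inclusion. $\mathcal{L}(V)$ is the lattice of all subspaces of $V$ and ${V\brack k}$ the set of those of rank $k$. For a subspace $U$ of $V$, $\boldsymbol{x}_U^{(k)}$ is the characteristic function of $\{K\in{V\brack k}\mid U\le K\}$. For $i\in\{0,\ldots,\min(k,n-k)\}$, $\bar V_i^{(k)}\subseteq\mathbb{R}^{{V\brack k}}$ is the real span of $\{\boldsymbol{x}_I^{(k)}\mid I\in{V\brack i}\}$; these spaces form an increasing chain with $\bar V^{(k)}_{\min(k,n-k)}=\mathbb{R}^{{V\brack k}}$. The degree $\deg(f)$ of a non-zero $f:{V\brack k}\to\mathbb{R}$ is the smallest $t\in\{0,\ldots,\min(k,n-k)\}$ with $f\in\bar V_t^{(k)}$; $\deg(\boldsymbol 0)=-\infty$. Dualization: fix an anti-automorphism (order-reversing bijection) $U\mapsto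 U^\perp$ of $\mathcal{L}(V)$, e.g. $U\mapsto V\setminus U$ for $q=1$, or the orthogonal space with respect to a non-degenerate bilinear form for $q\ge2$. It maps ${V\brack k}$ bijectively onto ${V\brack n-k}$. The dualized function of $f:{V\brack k}\to\mathbb{R}$ is $f^\perp:{V\brack n-k}\to\mathbb{R}$ with $f^\perp(K^\perp)=f(K)$ for $K\in{V\brack k}$. (Here $(\cdot)^\perp$ applied to sets of functions is the element-wise dualization, not an orthogonal complement.) -}

module Defs where

module Reals where

  open import Algebra.Bundles using (CommutativeRing)
  import Algebra.Properties.CommutativeSemigroup
  open import Data.Nat.Base as ℕ using (ℕ; _⊔_)
  import Data.Nat.Properties as ℕ
  open import Data.Product.Base using (_×_; _,_; ∃; proj₁; proj₂)
  open import Data.Rational.Base using (ℚ; 0ℚ; 1ℚ; ½; _<_; _≤_; _+_; _*_; _-_; -_; ∣_∣; 1/_; positive)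
  import Data.Rational.Properties as ℚ
  open import Algebra.Properties.Group ℚ.+-0-group using (⁻¹-involutive)
  open import Function.Base using (_∘_)
  open import Level using (0ℓ)
  open import Relation.Binary.PropositionalEquality as ≡ using (_≡_; _≗_)

  -- The real numbers: Cauchy sequences of rationals modulo null sequences.
  record ℝ : Set where
    no-eta-equality
    field
      seq    : ℕ → ℚ
      cauchy : ∀ {ε} → 0ℚ < ε → ∃ λ N → ∀ {m n} → N ℕ.≤ m × N ℕ.≤ n → ∣ seq m - seq n ∣ < ε

  open ℝ public

  infix 4 _≈ᴿ_
  record _≈ᴿ_ (x y : ℝ) : Set where
    constructor null
    field
      close : ∀ {ε} → 0ℚ < ε → ∃ λ N → ∀ {n} → N ℕ.≤ n → ∣ seq x n - seq y n ∣ < ε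

  open _≈ᴿ_ public

  private
    restore : ∀ a b → (a - b) + b ≡ a
    restore a b = begin
      (a - b) + b     ≡⟨ ℚ.+-assoc a (- b) b ⟩
      a + (- b + b)   ≡⟨ ≡.cong (a +_) (ℚ.+-inverseˡ b) ⟩
      a + 0ℚ          ≡⟨ ℚ.+-identityʳ a ⟩
      a               ∎
      where open ≡.≡-Reasoning

    interchange : ∀ a b c d → (a - b) + (c - d) ≡ (a + c) - (b + d)
    interchange a b c d = begin
      (a - b) + (c - d)         ≡⟨ CommSemigroup.interchange a (- b) c (- d) ⟩
      (a + c) + (- b + - d)     ≡⟨ ≡.cong (a + c +_) (ℚ.neg-distrib-+ b d) ⟨
      (a + c) - (b + d)         ∎
      where
      open ≡.≡-Reasoning
      module CommSemigroup = Algebra.Properties.CommutativeSemigroup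
        (CommutativeRing.+-commutativeSemigroup ℚ.+-*-commutativeRing)

    flip-sign : ∀ a b → - (a - b) ≡ b - a
    flip-sign a b = begin
      - (a - b)       ≡⟨ ℚ.neg-distrib-+ a (- b) ⟩
      - a + - (- b)   ≡⟨ ≡.cong (- a +_) (⁻¹-involutive b) ⟩
      - a + b         ≡⟨ ℚ.+-comm (- a) b ⟩
      b - a           ∎
      where open ≡.≡-Reasoning

    telescope : ∀ a b c → (a - b) + (b - c) ≡ a - c
    telescope a b c = begin
      (a - b) + (b - c)   ≡⟨ ℚ.+-assoc (a - b) b (- c) ⟨
      (a - b) + b - c     ≡⟨ ≡.cong (_- c) (restore a b) ⟩
      a - c               ∎
      where open ≡.≡-Reasoning

    distrib : ∀ a b c → a * (b - c) ≡ a * b - a * c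
    distrib a b c = ≡.trans (ℚ.*-distribˡ-+ a b (- c))
                            (≡.cong (a * b +_) (≡.sym (ℚ.neg-distribʳ-* a c)))

    product : ∀ a b c d → a * (c - d) + d * (a - b) ≡ a * c - b * d
    product a b c d = begin
      a * (c - d) + d * (a - b)             ≡⟨ ≡.cong₂ _+_ (distrib a c d) (distrib d a b) ⟩
      (a * c - a * d) + (d * a - d * b)     ≡⟨ ≡.cong₂ (λ u v → (a * c - a * d) + (u - v)) (ℚ.*-comm d a) (ℚ.*-comm d b) ⟩
      (a * c - a * d) + (a * d - b * d)     ≡⟨ telescope (a * c) (a * d) (b * d) ⟩
      a * c - b * d                         ∎
      where open ≡.≡-Reasoning

  -- E N i reads "the index i lies beyond N"; it is used for single indices and for
  -- pairs of indices.
  module Vanishing {I : Set} (E : ℕ → I → Set)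
                   (E-anti : ∀ {M N i} → M ℕ.≤ N → E N i → E M i) where

    Small : (I → ℚ) → Set
    Small d = ∀ {ε} → 0ℚ < ε → ∃ λ N → ∀ {i} → E N i → ∣ d i ∣ < ε

    Bounded : (I → ℚ) → Set
    Bounded d = ∃ λ B → 0ℚ < B × ∃ λ N → ∀ {i} → E N i → ∣ d i ∣ ≤ B

    private
      halve : ∀ {ε} → 0ℚ < ε → 0ℚ < ½ * ε
      halve {ε} 0<ε = ≡.subst (_< ½ * ε) (ℚ.*-zeroʳ ½) (ℚ.*-monoʳ-<-pos ½ 0<ε)

      halves : ∀ ε → ½ * ε + ½ * ε ≡ ε
      halves ε = ≡.trans (≡.sym (ℚ.*-distribʳ-+ ε ½ ½)) (ℚ.*-identityˡ ε)

    small-cong : ∀ {d e} → d ≗ e → Small d → Small e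
    small-cong d≗e sd 0<ε with N , h ← sd 0<ε =
      N , λ {i} p → ≡.subst (λ z → ∣ z ∣ < _) (d≗e i) (h p)

    small-0 : Small (λ _ → 0ℚ)
    small-0 0<ε = 0 , λ _ → 0<ε

    small-neg : ∀ {d} → Small d → Small (-_ ∘ d)
    small-neg {d} sd 0<ε with N , h ← sd 0<ε =
      N , λ {i} p → ≡.subst (_< _) (≡.sym (ℚ.∣-p∣≡∣p∣ (d i))) (h p)

    small-+ : ∀ {d e} → Small d → Small e → Small (λ i → d i + e i)
    small-+ {d} {e} sd se {ε} 0<ε
      with M , f ← sd (halve 0<ε) | N , g ← se (halve 0<ε) = M ⊔ N , λ {i} p → begin-strict
        ∣ d i + e i ∣       ≤⟨ ℚ.∣p+q∣≤∣p∣+∣q∣ (d i) (e i) ⟩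
        ∣ d i ∣ + ∣ e i ∣   <⟨ ℚ.+-mono-< (f (E-anti (ℕ.m≤m⊔n M N) p)) (g (E-anti (ℕ.m≤n⊔m M N) p)) ⟩
        ½ * ε + ½ * ε       ≡⟨ halves ε ⟩
        ε                   ∎
      where open ℚ.≤-Reasoning

    small-* : ∀ {d e} → Bounded d → Small e → Small (λ i → d i * e i)
    small-* {d} {e} (B , 0<B , M , f) se {ε} 0<ε = M ⊔ N , λ {i} p → begin-strict
        ∣ d i * e i ∣       ≡⟨ ℚ.∣p*q∣≡∣p∣*∣q∣ (d i) (e i) ⟩
        ∣ d i ∣ * ∣ e i ∣   ≤⟨ ℚ.*-monoʳ-≤-nonNeg ∣ e i ∣ {{ℚ.∣-∣-nonNeg (e i)}} (f (E-anti (ℕ.m≤m⊔n M N) p)) ⟩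
        B * ∣ e i ∣         <⟨ ℚ.*-monoʳ-<-pos B (g (E-anti (ℕ.m≤n⊔m M N) p)) ⟩
        B * (1/ B * ε)      ≡⟨ ≡.sym (ℚ.*-assoc B (1/ B) ε) ⟩
        B * 1/ B * ε        ≡⟨ ≡.cong (_* ε) (ℚ.*-inverseʳ B) ⟩
        1ℚ * ε              ≡⟨ ℚ.*-identityˡ ε ⟩
        ε                   ∎
      where
      open ℚ.≤-Reasoning
      instance
        B-pos = positive 0<B
        B-nonZero = ℚ.pos⇒nonZero B
        B⁻¹-pos = ℚ.1/pos⇒pos B
      0<δ : 0ℚ < 1/ B * ε
      0<δ = ≡.subst (_< 1/ B * ε) (ℚ.*-zeroʳ (1/ B)) (ℚ.*-monoʳ-<-pos (1/ B) 0<ε)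
      N = proj₁ (se 0<δ)
      g = proj₂ (se 0<δ)

  private
    Beyond : ℕ → ℕ × ℕ → Set
    Beyond N (m , n) = N ℕ.≤ m × N ℕ.≤ n

    beyond-anti : ∀ {M N i} → M ℕ.≤ N → Beyond N i → Beyond M i
    beyond-anti M≤N (p , q) = ℕ.≤-trans M≤N p , ℕ.≤-trans M≤N q

    module S = Vanishing ℕ._≤_ ℕ.≤-trans
    module D = Vanishing Beyond (λ {M} {N} {i} → beyond-anti {M} {N} {i})

    small² : ∀ x → D.Small (λ { (m , n) → seq x m - seq x n })
    small² x 0<ε with N , h ← cauchy x 0<ε = N , λ { {_ , _} → h }

    bounded : ∀ x → S.Bounded (seq x)
    bounded x with N , h ← cauchy x {1ℚ} (ℚ.positive⁻¹ 1ℚ) =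
      1ℚ + ∣ seq x N ∣ ,
      ℚ.+-mono-<-≤ (ℚ.positive⁻¹ 1ℚ) (ℚ.0≤∣p∣ (seq x N)) ,
      N , λ {i} p → begin
        ∣ seq x i ∣                           ≡⟨ ≡.cong ∣_∣ (≡.sym (restore (seq x i) (seq x N))) ⟩
        ∣ (seq x i - seq x N) + seq x N ∣     ≤⟨ ℚ.∣p+q∣≤∣p∣+∣q∣ (seq x i - seq x N) (seq x N) ⟩
        ∣ seq x i - seq x N ∣ + ∣ seq x N ∣   ≤⟨ ℚ.+-monoˡ-≤ ∣ seq x N ∣ (ℚ.<⇒≤ (h (p , ℕ.≤-refl))) ⟩
        1ℚ + ∣ seq x N ∣                      ∎
      where
      open ℚ.≤-Reasoning

    bounded₁ bounded₂ : ∀ x → D.Bounded _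
    bounded₁ x with B , 0<B , N , h ← bounded x = B , 0<B , N , λ { {m , n} (p , _) → h {m} p }
    bounded₂ x with B , 0<B , N , h ← bounded x = B , 0<B , N , λ { {m , n} (_ , q) → h {n} q }

  fromℚ : ℚ → ℝ
  fromℚ p = record
    { seq    = λ _ → p
    ; cauchy = λ 0<ε → 0 , λ _ → ≡.subst (λ z → ∣ z ∣ < _) (≡.sym (ℚ.+-inverseʳ p)) 0<ε
    }

  0ᴿ 1ᴿ : ℝ
  0ᴿ = fromℚ 0ℚ
  1ᴿ = fromℚ 1ℚ

  infixl 6 _+ᴿ_
  infixl 7 _*ᴿ_
  infix  8 -ᴿ_

  _+ᴿ_ : ℝ → ℝ → ℝ
  x +ᴿ y = record
    { seq    = λ n → seq x n + seq y n
    ; cauchy = λ 0<ε → let N , h = sm 0<ε in N , λ {m} {n} → h {m , n}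
    }
    where
    sm = D.small-cong
      (λ { (m , n) → interchange (seq x m) (seq x n) (seq y m) (seq y n) })
      (D.small-+ (small² x) (small² y))

  -ᴿ_ : ℝ → ℝ
  -ᴿ x = record
    { seq    = λ n → - seq x n
    ; cauchy = λ 0<ε → let N , h = sm 0<ε in N , λ {m} {n} → h {m , n}
    }
    where
    sm = D.small-cong
      (λ { (m , n) → ℚ.neg-distrib-+ (seq x m) (- seq x n) })
      (D.small-neg (small² x))

  _*ᴿ_ : ℝ → ℝ → ℝ
  x *ᴿ y = record
    { seq    = λ n → seq x n * seq y n
    ; cauchy = λ 0<ε → let N , h = sm 0<ε in N , λ {m} {n} → h {m , n}
    }
    where
    sm = D.small-cong
      (λ { (m , n) → product (seq x m) (seq x n) (seq y m) (seq y n) })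
      (D.small-+ (D.small-* (bounded₁ x) (small² y)) (D.small-* (bounded₂ y) (small² x)))

  ≗⇒≈ᴿ : ∀ {x y} → seq x ≗ seq y → x ≈ᴿ y
  ≗⇒≈ᴿ {x} {y} h = null
    (S.small-cong (λ n → ≡.sym (≡.trans (≡.cong (_- seq y n) (h n)) (ℚ.+-inverseʳ (seq y n)))) S.small-0)

  ≈ᴿ-sym : ∀ {x y} → x ≈ᴿ y → y ≈ᴿ x
  ≈ᴿ-sym {x} {y} (null h) = null
    (S.small-cong (λ n → flip-sign (seq x n) (seq y n)) (S.small-neg h))

  ≈ᴿ-trans : ∀ {x y z} → x ≈ᴿ y → y ≈ᴿ z → x ≈ᴿ z
  ≈ᴿ-trans {x} {y} {z} (null h) (null k) = null
    (S.small-cong (λ n → telescope (seq x n) (seq y n) (seq z n))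
                  (S.small-+ h k))

  +ᴿ-cong : ∀ {x y u v} → x ≈ᴿ y → u ≈ᴿ v → x +ᴿ u ≈ᴿ y +ᴿ v
  +ᴿ-cong {x} {y} {u} {v} (null h) (null k) = null
    (S.small-cong (λ n → interchange (seq x n) (seq y n) (seq u n) (seq v n))
                  (S.small-+ h k))

  -ᴿ-cong : ∀ {x y} → x ≈ᴿ y → -ᴿ x ≈ᴿ -ᴿ y
  -ᴿ-cong {x} {y} (null h) = null
    (S.small-cong (λ n → ℚ.neg-distrib-+ (seq x n) (- seq y n)) (S.small-neg h))

  *ᴿ-cong : ∀ {x y u v} → x ≈ᴿ y → u ≈ᴿ v → x *ᴿ u ≈ᴿ y *ᴿ v
  *ᴿ-cong {x} {y} {u} {v} (null h) (null k) = null
    (S.small-cong (λ n → product (seq x n) (seq y n) (seq u n) (seq v n))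
                  (S.small-+ (S.small-* (bounded x) k) (S.small-* (bounded v) h)))

  ℝ-commutativeRing : CommutativeRing 0ℓ 0ℓ
  ℝ-commutativeRing = record
    { Carrier = ℝ ; _≈_ = _≈ᴿ_ ; _+_ = _+ᴿ_ ; _*_ = _*ᴿ_ ; -_ = -ᴿ_ ; 0# = 0ᴿ ; 1# = 1ᴿ
    ; isCommutativeRing = record
      { isRing = record
        { +-isAbelianGroup = record
          { isGroup = record
            { isMonoid = record
              { isSemigroup = record
                { isMagma = record
                  { isEquivalence = record
                    { refl  = ≗⇒≈ᴿ λ _ → ≡.refl
                    ; sym   = ≈ᴿ-sym
                    ; trans = ≈ᴿ-trans
                    }
                  ; ∙-cong = +ᴿ-cong
                  }
                ; assoc = λ x y z → ≗⇒≈ᴿ λ n → ℚ.+-assoc (seq x n) (seq y n) (seq z n)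
                }
              ; identity = (λ x → ≗⇒≈ᴿ λ n → ℚ.+-identityˡ (seq x n))
                         , (λ x → ≗⇒≈ᴿ λ n → ℚ.+-identityʳ (seq x n))
              }
            ; inverse = (λ x → ≗⇒≈ᴿ λ n → ℚ.+-inverseˡ (seq x n))
                      , (λ x → ≗⇒≈ᴿ λ n → ℚ.+-inverseʳ (seq x n))
            ; ⁻¹-cong = -ᴿ-cong
            }
          ; comm = λ x y → ≗⇒≈ᴿ λ n → ℚ.+-comm (seq x n) (seq y n)
          }
        ; *-cong = *ᴿ-cong
        ; *-assoc = λ x y z → ≗⇒≈ᴿ λ n → ℚ.*-assoc (seq x n) (seq y n) (seq z n)
        ; *-identity = (λ x → ≗⇒≈ᴿ λ n → ℚ.*-identityˡ (seq x n))
                     , (λ x → ≗⇒≈ᴿ λ n → ℚ.*-identityʳ (seq x n))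
        ; distrib = (λ x y z → ≗⇒≈ᴿ λ n → ℚ.*-distribˡ-+ (seq x n) (seq y n) (seq z n))
                  , (λ x y z → ≗⇒≈ᴿ λ n → ℚ.*-distribʳ-+ (seq x n) (seq y n) (seq z n))
        }
      ; *-comm = λ x y → ≗⇒≈ᴿ λ n → ℚ.*-comm (seq x n) (seq y n)
      }
    }

open Reals public

module RankedLattices where

  open import Algebra.Bundles using (CommutativeRing)
  open import Algebra.Properties.Monoid.Sum (CommutativeRing.+-monoid ℝ-commutativeRing) using (sum)
  open import Data.Bool.Base using (if_then_else_)
  open import Data.Empty using (⊥-elim)
  open import Data.Fin.Base using (Fin)
  open import Data.Nat.Base as ℕ using (ℕ; zero; suc; _∸_; _⊓_)
  import Data.Nat.Properties as ℕ
  open import Data.Product.Base using (_×_; _,_; ∃; ∃₂; Σ; proj₁; proj₂; swap)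
  open import Function.Base using (flip)
  open import Function.Bundles using (Func)
  open import Level using (0ℓ)
  open import Relation.Binary.Bundles using (Setoid)
  open import Relation.Binary.Core using (Rel)
  open import Relation.Binary.Definitions using (Reflexive; Transitive; Decidable)
  open import Relation.Binary.Morphism.Structures using (IsOrderIsomorphism)
  open import Relation.Binary.PropositionalEquality as ≡ using (_≡_; refl)
  open import Relation.Nullary.Construct.Add.Infimum using (_₋; ⊥₋; [_])
  open import Relation.Nullary.Decidable.Core using (Dec; yes; no; does)
  open import Relation.Nullary.Negation.Core using (¬_)
  open import Relation.Unary using (Pred)

  -- The interface shared by subset lattices and linear subspace lattices. It is instantiated
  -- only at these two; the fields from ≤-refl onwards are the facts about them which are
  -- needed to define χ and dual as functions.
  record RankedLattice (n : ℕ) : Set₁ where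
    infix 4 _≤_ _≤?_
    field
      Subspace : Set
      _≤_      : Rel Subspace 0ℓ
      HasRank  : Subspace → ℕ → Set

      ≤-refl  : Reflexive _≤_
      ≤-trans : Transitive _≤_
      _≤?_    : Decidable _≤_

      bottom    : ∃ λ U → HasRank U 0 × ∀ W → U ≤ W
      top       : ∃ λ U → HasRank U n × ∀ W → W ≤ U
      rank-cong : ∀ {U W k} → U ≤ W → W ≤ U → HasRank U k → HasRank W k
      rank-mono : ∀ {U W a b} → HasRank U a → HasRank W b → U ≤ W → a ℕ.≤ b
      rank-<    : ∀ {U W a b} → HasRank U a → HasRank W b → U ≤ W → ¬ W ≤ U → a ℕ.< b
      extend    : ∀ {U W a} → HasRank U a → U ≤ W → ¬ W ≤ U →
                  ∃ λ U′ → HasRank U′ (suc a) × U ≤ U′ × U′ ≤ W × ¬ U′ ≤ U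

    infix 4 _≈_
    _≈_ : Rel Subspace 0ℓ
    U ≈ W = U ≤ W × W ≤ U

    rank-unique : ∀ {U a b} → HasRank U a → HasRank U b → a ≡ b
    rank-unique r s = ℕ.≤-antisym (rank-mono r s ≤-refl) (rank-mono s r ≤-refl)

    hasRank : ∀ W → ∃ (HasRank W)
    hasRank W = let U , r , U≤ = bottom in grow n U r (U≤ W) (ℕ.m≤m+n n 0)
      where
      grow : ∀ m {a} U → HasRank U a → U ≤ W → n ℕ.≤ m ℕ.+ a → ∃ (HasRank W)
      grow m {a} U r U≤W n≤ with W ≤? U
      ... | yes W≤U = a , rank-cong U≤W W≤U r
      grow zero U r U≤W n≤ | no W≰U = let T , t , ≤T = top in
        ⊥-elim (ℕ.<⇒≱ (rank-< r t (≤T U) λ T≤U → W≰U (≤-trans (≤T W) T≤U)) n≤)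
      grow (suc m) {a} U r U≤W n≤ | no W≰U with U′ , r′ , _ , U′≤W , _ ← extend r U≤W W≰U =
        grow m U′ r′ U′≤W (≡.subst (n ℕ.≤_) (≡.sym (ℕ.+-suc m a)) n≤)

    -- An order isomorphism onto the opposite order.
    record AntiAutomorphism : Set where
      infix 8 _^⊥
      field
        _^⊥               : Subspace → Subspace
        isAntiautomorphism : IsOrderIsomorphism _≈_ _≈_ _≤_ (flip _≤_) _^⊥

      open IsOrderIsomorphism isAntiautomorphism public

      infix 8 _^⊥⁻¹
      _^⊥⁻¹ : Subspace → Subspace
      W ^⊥⁻¹ = proj₁ (surjective W)

      ⊥⁻¹-⊥ : ∀ W → (W ^⊥⁻¹) ^⊥ ≈ W
      ⊥⁻¹-⊥ W = proj₂ (surjective W) (≤-refl , ≤-refl)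

      private
        -- d + b ≤ c + a, i.e. the rank drops from U ^⊥ to W ^⊥ by at least b - a.
        drop : ∀ m {U W a b c d} → b ℕ.≤ m ℕ.+ a → HasRank U a → HasRank W b → U ≤ W →
               HasRank (U ^⊥) c → HasRank (W ^⊥) d → d ℕ.+ b ℕ.≤ c ℕ.+ a
        drop m {U} {W} b≤ ra rb U≤W rc rd with W ≤? U
        ... | yes W≤U
          with refl ← rank-unique (rank-cong U≤W W≤U ra) rb
             | refl ← rank-unique (rank-cong (mono W≤U) (mono U≤W) rc) rd = ℕ.≤-refl
        drop zero b≤ ra rb U≤W rc rd | no W≰U = ⊥-elim (ℕ.<⇒≱ (rank-< ra rb U≤W W≰U) b≤)
        drop (suc m) {U} {W} {a} {b} {c} {d} b≤ ra rb U≤W rc rd | no W≰U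
          with U′ , r′ , U≤U′ , U′≤W , U′≰U ← extend ra U≤W W≰U
          with c′ , rc′ ← hasRank (U′ ^⊥) = begin
            d ℕ.+ b        ≤⟨ drop m (≡.subst (b ℕ.≤_) (≡.sym (ℕ.+-suc m a)) b≤) r′ rb U′≤W rc′ rd ⟩
            c′ ℕ.+ suc a   ≡⟨ ℕ.+-suc c′ a ⟩
            suc c′ ℕ.+ a   ≤⟨ ℕ.+-monoˡ-≤ a (rank-< rc′ rc (mono U≤U′) λ U⊥≤U′⊥ → U′≰U (cancel U⊥≤U′⊥)) ⟩
            c ℕ.+ a        ∎
          where open ℕ.≤-Reasoning

      rank-⊥ : ∀ {U a c} → HasRank U a → HasRank (U ^⊥) c → c ℕ.+ a ≡ n
      rank-⊥ {U} {a} {c} ra rc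
        with B , rB , B≤ ← bottom | T , rT , ≤T ← top
        with b , rB⊥ ← hasRank (B ^⊥) | t , rT⊥ ← hasRank (T ^⊥) = ℕ.≤-antisym
          (begin
            c ℕ.+ a   ≤⟨ drop a (ℕ.m≤m+n a 0) rB ra (B≤ U) rB⊥ rc ⟩
            b ℕ.+ 0   ≡⟨ ℕ.+-identityʳ b ⟩
            b         ≤⟨ rank-mono rB⊥ rT (≤T (B ^⊥)) ⟩
            n         ∎)
          (begin
            n         ≤⟨ ℕ.m≤n+m n t ⟩
            t ℕ.+ n   ≤⟨ drop n (ℕ.m≤m+n n a) ra rT (≤T U) rc rT⊥ ⟩
            c ℕ.+ a   ∎)
        where open ℕ.≤-Reasoning

      rank-⊥⁻¹ : ∀ {k} → k ℕ.≤ n → ∀ {W} → HasRank W (n ∸ k) → HasRank (W ^⊥⁻¹) k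
      rank-⊥⁻¹ {k} k≤n {W} r with u , ru ← hasRank (W ^⊥⁻¹) = ≡.subst (HasRank _) u≡k ru
        where
        W≈ = ⊥⁻¹-⊥ W
        u≡k : u ≡ k
        u≡k = ℕ.+-cancelˡ-≡ (n ∸ k) u k
          (≡.trans (rank-⊥ ru (rank-cong (proj₂ W≈) (proj₁ W≈) r)) (≡.sym (ℕ.m∸n+n≡m k≤n)))

  module _ {n} (L : RankedLattice n) where
    open RankedLattice L

    -- Rank k subspaces; the rank witness is ignored by the equality.
    subspaces : ℕ → Setoid 0ℓ 0ℓ
    subspaces k = record
      { Carrier       = Σ Subspace λ U → HasRank U k
      ; _≈_           = λ (U , _) (W , _) → U ≈ W
      ; isEquivalence = record
        { refl  = ≤-refl , ≤-refl
        ; sym   = swap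
        ; trans = λ (p , q) (r , s) → ≤-trans p r , ≤-trans s q
        }
      }

    Fun : ℕ → Set
    Fun k = Func (subspaces k) (CommutativeRing.setoid ℝ-commutativeRing)

    module _ {k : ℕ} where
      open Func

      infix 4 _≈ᶠ_
      _≈ᶠ_ : Rel (Fun k) 0ℓ
      f ≈ᶠ g = ∀ K → to f K ≈ᴿ to g K

      𝟎 : Fun k
      𝟎 = record { to = λ _ → 0ᴿ ; cong = λ _ → CommutativeRing.refl ℝ-commutativeRing }

    -- The characteristic function of the rank k subspaces above U.
    χ : Subspace → ∀ k → Fun k
    χ U k = record { to = λ (K , _) → indicator (U ≤? K) ; cong = λ {(K , _)} {(K′ , _)} → resp K K′ }
      where
      indicator : ∀ {P : Set} → Dec P → ℝ
      indicator P? = if does P? then 1ᴿ else 0ᴿ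
      resp : ∀ K K′ → K ≈ K′ → indicator (U ≤? K) ≈ᴿ indicator (U ≤? K′)
      resp K K′ (K≤K′ , K′≤K) with U ≤? K | U ≤? K′
      ... | yes _ | yes _ = CommutativeRing.refl ℝ-commutativeRing
      ... | no _  | no _  = CommutativeRing.refl ℝ-commutativeRing
      ... | yes p | no ¬q = ⊥-elim (¬q (≤-trans p K≤K′))
      ... | no ¬p | yes q = ⊥-elim (¬p (≤-trans q K′≤K))

    -- The real span of a family of functions.
    Span : ∀ {k} {X : Set} → (X → Fun k) → Pred (Fun k) 0ℓ
    Span {X = X} x f = ∃ λ m → ∃₂ λ (c : Fin m → ℝ) (I : Fin m → X) →
      ∀ K → Func.to f K ≈ᴿ sum (λ j → c j *ᴿ Func.to (x (I j)) K)

    V̄ : (k i : ℕ) → Pred (Fun k) 0ℓ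
    V̄ k i = Span {X = Setoid.Carrier (subspaces i)} λ (I , _) → χ I k

    -- The degree as a relation, since whether a real function vanishes is not decidable
    -- constructively; ⊥₋ stands for -∞.
    HasDegree : ∀ {k} → Fun k → ℕ ₋ → Set
    HasDegree f ⊥₋ = f ≈ᶠ 𝟎
    HasDegree {k} f [ t ] = ¬ f ≈ᶠ 𝟎 × t ℕ.≤ k ⊓ (n ∸ k) × V̄ k t f ×
      (∀ s → s ℕ.≤ k ⊓ (n ∸ k) → V̄ k s f → t ℕ.≤ s)

    module _ (A : AntiAutomorphism) {k} (k≤n : k ℕ.≤ n) where
      open AntiAutomorphism A

      -- f^⊥ takes W to f at the preimage of W under ⊥, which has rank k by rank-⊥⁻¹.
      dual : Fun k → Fun (n ∸ k)
      dual f = record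
        { to   = λ (W , r) → Func.to f (W ^⊥⁻¹ , rank-⊥⁻¹ k≤n r)
        ; cong = λ {(W , _)} {(W′ , _)} (p , q) → Func.cong f
            ( cancel (≤-trans (proj₁ (⊥⁻¹-⊥ W′)) (≤-trans q (proj₂ (⊥⁻¹-⊥ W))))
            , cancel (≤-trans (proj₁ (⊥⁻¹-⊥ W)) (≤-trans p (proj₂ (⊥⁻¹-⊥ W′)))))
        }

      -- f^⊥(K^⊥) = f(K), which determines dual f.
      dual-⊥ : ∀ f K r s → Func.to (dual f) (K ^⊥ , s) ≈ᴿ Func.to f (K , r)
      dual-⊥ f K r s = Func.cong f (cancel (proj₂ (⊥⁻¹-⊥ (K ^⊥))) , cancel (proj₁ (⊥⁻¹-⊥ (K ^⊥))))

      dualSet : Pred (Fun k) 0ℓ → Pred (Fun (n ∸ k)) 0ℓ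
      dualSet P g = ∃ λ f → P f × g ≈ᶠ dual f

open RankedLattices public

module FiniteSets where

  open import Data.Bool.Base using (Bool; true; false; T; _∨_)
  open import Data.Bool.Properties using (T?; T-irrelevant; T-∨)
  open import Data.Empty using (⊥-elim)
  open import Data.Fin.Base using (Fin; zero; suc)
  open import Data.Fin.Properties using (all?; ¬∀⟶∃¬; injective⇒≤)
  open import Data.Nat.Base as ℕ using (ℕ; zero; suc)
  open import Data.Product.Base using (_×_; _,_; ∃; proj₁; proj₂)
  open import Data.Sum.Base using (inj₁; inj₂)
  open import Data.Unit.Base using (tt)
  open import Function.Base using (_∘_)
  open import Function.Bundles using (_↔_; Inverse; Equivalence; mk↔ₛ′)
  open import Function.Definitions using (Injective)
  open import Relation.Binary.Definitions using (DecidableEquality)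
  open import Relation.Binary.PropositionalEquality as ≡ using (_≡_; _≢_; refl)
  open import Relation.Nullary.Decidable.Core using (Dec; yes; no; does; map′; _→-dec_; decidable-stable)
  open import Relation.Nullary.Negation.Core using (¬_)

  module Subsets {A : Set} {n : ℕ} (A-finite : Fin n ↔ A) where

    -- Subsets and linear subspaces are Boolean-valued: membership is decidable, as it is
    -- classically for any subset of a finite set.
    Subset : Set
    Subset = A → Bool

    infix 4 _⊆_ _⊆?_
    _⊆_ : Subset → Subset → Set
    U ⊆ W = ∀ x → T (U x) → T (W x)

    HasSize : Subset → ℕ → Set
    HasSize U k = Fin k ↔ ∃ (T ∘ U)

    open Inverse A-finite using () renaming (to to elem; from to index; strictlyInverseˡ to elem-index)

    index-injective : ∀ {x y} → index x ≡ index y → x ≡ y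
    index-injective {x} {y} p = ≡.trans (≡.sym (elem-index x)) (≡.trans (≡.cong elem p) (elem-index y))

    abstract
      _≟_ : DecidableEquality A
      x ≟ y = map′ index-injective (≡.cong index) (index x Data.Fin.Properties.≟ index y)

    ⊆-at? : ∀ (U W : Subset) j → Dec (T (U (elem j)) → T (W (elem j)))
    ⊆-at? U W j = T? (U (elem j)) →-dec T? (W (elem j))

    _⊆?_ : ∀ U W → Dec (U ⊆ W)
    U ⊆? W = map′ (λ h x → ≡.subst (λ z → T (U z) → T (W z)) (elem-index x) (h (index x)))
                  (λ h j → h (elem j))
                  (all? (⊆-at? U W))

    witness : ∀ {U W} → ¬ U ⊆ W → ∃ λ x → T (U x) × ¬ T (W x)
    witness {U} {W} U⊈W
      with j , h ← ¬∀⟶∃¬ n _ (⊆-at? U W) (λ h → U⊈W λ x →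
             ≡.subst (λ z → T (U z) → T (W z)) (elem-index x) (h (index x)))
      = elem j , decidable-stable (T? _) (λ ¬u → h (⊥-elim ∘ ¬u)) , λ w → h λ _ → w

    injection⇒≤ : ∀ {W a b} (f : Fin a → A) → Injective _≡_ _≡_ f → (∀ j → T (W (f j))) →
                  HasSize W b → a ℕ.≤ b
    injection⇒≤ f f-inj f∈W s = injective⇒≤ {f = λ j → Inverse.from s (f j , f∈W j)} λ {i} {j} p →
      f-inj (≡.cong proj₁ (≡.trans (≡.sym (Inverse.strictlyInverseˡ s (f i , f∈W i)))
                          (≡.trans (≡.cong (Inverse.to s) p) (Inverse.strictlyInverseˡ s (f j , f∈W j)))))

    ∃T-≡ : ∀ {U : Subset} {x y} {p : T (U x)} {q : T (U y)} → x ≡ y → (x , p) ≡ (y , q)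
    ∃T-≡ refl = ≡.cong (_ ,_) (T-irrelevant _ _)

    enum-injective : ∀ {U a} (r : HasSize U a) {i j} →
                     proj₁ (Inverse.to r i) ≡ proj₁ (Inverse.to r j) → i ≡ j
    enum-injective r {i} {j} p = ≡.trans (≡.sym (Inverse.strictlyInverseʳ r i))
      (≡.trans (≡.cong (Inverse.from r) (∃T-≡ p)) (Inverse.strictlyInverseʳ r j))

    size-cong : ∀ {U W k} → U ⊆ W → W ⊆ U → HasSize U k → HasSize W k
    size-cong U⊆W W⊆U r = mk↔ₛ′
      (λ i → let x , p = to i in x , U⊆W x p)
      (λ (x , p) → from (x , W⊆U x p))
      (λ (x , p) → ∃T-≡ (≡.cong proj₁ (strictlyInverseˡ (x , W⊆U x p))))
      (λ i → ≡.trans (≡.cong from (∃T-≡ refl)) (strictlyInverseʳ i))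
      where open Inverse r

    size-mono : ∀ {U W a b} → HasSize U a → HasSize W b → U ⊆ W → a ℕ.≤ b
    size-mono r s U⊆W = injection⇒≤ (proj₁ ∘ Inverse.to r) (enum-injective r)
                          (λ j → let x , p = Inverse.to r j in U⊆W x p) s

    size-< : ∀ {U W a b} → HasSize U a → HasSize W b → U ⊆ W → ¬ W ⊆ U → a ℕ.< b
    size-< {U} {W} {a} r s U⊆W W⊈U with x , x∈W , x∉U ← witness W⊈U =
      injection⇒≤ f f-inj f∈W s
      where
      f : Fin (suc a) → A
      f zero    = x
      f (suc j) = proj₁ (Inverse.to r j)
      f-inj : Injective _≡_ _≡_ f
      f-inj {zero}  {zero}  _    = refl
      f-inj {zero}  {suc j} refl = ⊥-elim (x∉U (proj₂ (Inverse.to r j)))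
      f-inj {suc i} {zero}  refl = ⊥-elim (x∉U (proj₂ (Inverse.to r i)))
      f-inj {suc i} {suc j} p    = ≡.cong suc (enum-injective r p)
      f∈W : ∀ j → T (W (f j))
      f∈W zero    = x∈W
      f∈W (suc j) = let y , p = Inverse.to r j in U⊆W y p

    insert : A → Subset → Subset
    insert x U y = does (x ≟ y) ∨ U y

    insert-size : ∀ {U a x} → HasSize U a → ¬ T (U x) → HasSize (insert x U) (suc a)
    insert-size {U} {a} {x} r x∉U = mk↔ₛ′ f g f∘g g∘f
      where
      open Inverse r
      f : Fin (suc a) → ∃ (T ∘ insert x U)
      f zero = x , Equivalence.from T-∨ (inj₁ x≡x)
        where
        x≡x : T (does (x ≟ x))
        x≡x with x ≟ x
        ... | yes _  = tt
        ... | no x≢x = x≢x refl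
      f (suc j) = let y , p = to j in y , Equivalence.from T-∨ (inj₂ p)
      old : ∀ {y} → x ≢ y → T (insert x U y) → T (U y)
      old {y} x≢y p with x ≟ y
      ... | yes x≡y = ⊥-elim (x≢y x≡y)
      ... | no _    = p
      g′ : ∀ y → Dec (x ≡ y) → T (insert x U y) → Fin (suc a)
      g′ y (yes _)  p = zero
      g′ y (no x≢y) p = suc (from (y , old x≢y p))
      g : ∃ (T ∘ insert x U) → Fin (suc a)
      g (y , p) = g′ y (x ≟ y) p
      f∘g′ : ∀ y d p → proj₁ (f (g′ y d p)) ≡ y
      f∘g′ y (yes x≡y) p = x≡y
      f∘g′ y (no x≢y)  p = ≡.cong proj₁ (strictlyInverseˡ (y , old x≢y p))
      f∘g : ∀ y → f (g y) ≡ y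
      f∘g (y , p) = ∃T-≡ (f∘g′ y (x ≟ y) p)
      g∘f′ : ∀ j d → g′ (proj₁ (f j)) d (proj₂ (f j)) ≡ j
      g∘f′ zero    (yes _)   = refl
      g∘f′ zero    (no x≢x)  = ⊥-elim (x≢x refl)
      g∘f′ (suc j) (yes x≡y) = ⊥-elim (x∉U (≡.subst (T ∘ U) (≡.sym x≡y) (proj₂ (to j))))
      g∘f′ (suc j) (no _)    = ≡.cong suc (≡.trans (≡.cong from (∃T-≡ {U} refl)) (strictlyInverseʳ j))
      g∘f : ∀ j → g (f j) ≡ j
      g∘f j = g∘f′ j (x ≟ proj₁ (f j))

    subsetLattice : RankedLattice n
    subsetLattice = record
      { Subspace  = Subset
      ; _≤_       = _⊆_
      ; HasRank   = HasSize
      ; ≤-refl    = λ _ p → p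
      ; ≤-trans   = λ p q x → q x ∘ p x
      ; _≤?_      = _⊆?_
      ; bottom    = (λ _ → false) , mk↔ₛ′ (λ ()) (λ ()) (λ ()) (λ ()) , λ _ _ ()
      ; top       = (λ _ → true)
                  , mk↔ₛ′ (λ j → elem j , tt) (index ∘ proj₁) (λ (x , _) → ≡.cong (_, tt) (elem-index x))
                          (Inverse.strictlyInverseʳ A-finite)
                  , λ _ _ _ → tt
      ; rank-cong = size-cong
      ; rank-mono = size-mono
      ; rank-<    = size-<
      ; extend    = λ {U} {W} r U⊆W W⊈U → let x , x∈W , x∉U = witness W⊈U in
          insert x U , insert-size r x∉U ,
          (λ y p → Equivalence.from T-∨ (inj₂ p)) ,
          (λ y p → insert⊆ U⊆W x∈W y p) ,
          λ h → x∉U (h x (proj₂ (Inverse.to (insert-size r x∉U) zero)))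
      }
      where
      insert⊆ : ∀ {U W x} → U ⊆ W → T (W x) → insert x U ⊆ W
      insert⊆ {x = x} U⊆W x∈W y p with x ≟ y
      ... | yes refl = x∈W
      ... | no _     = U⊆W y p

open FiniteSets public

module VectorSpaces where

  open import Algebra.Bundles using (CommutativeRing)
  open import Algebra.Module.Bundles using (Module)
  import Algebra.Properties.Monoid.Sum
  import Algebra.Properties.Group
  import Algebra.Properties.Ring
  open import Data.Bool.Base using (Bool; true; T)
  open import Data.Bool.Properties using (T?)
  open import Data.Empty using (⊥-elim)
  open import Data.Fin.Base using (Fin; zero; suc; combine; finToFun; funToFin)
  open import Data.Fin.Properties using (all?; any?; ¬∀⟶∃¬; injective⇒≤; finToFun-funToFin; funToFin-finToFin)
  import Data.Fin.Properties as Fin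
  open import Data.Nat.Base as ℕ using (ℕ; zero; suc; _^_)
  import Data.Nat.Properties as ℕ
  open import Data.Product.Base using (_×_; _,_; ∃; proj₁; proj₂)
  open import Data.Unit.Base using (tt)
  open import Function.Base using (_∘_; const)
  open import Function.Bundles using (_⇔_; Inverse; Equivalence; mk⇔)
  open import Function.Definitions using (Injective)
  open import Level using (0ℓ)
  open import Relation.Binary.Definitions using (Decidable)
  open import Relation.Binary.PropositionalEquality as ≡ using (_≡_; _≗_; refl)
  import Relation.Binary.Reasoning.Setoid
  open import Relation.Nullary.Decidable.Core using (Dec; yes; no; map′; _→-dec_; decidable-stable; ⌊_⌋; toWitness; fromWitness)
  open import Relation.Nullary.Negation.Core using (¬_)

  record FiniteField (q : ℕ) : Set₁ where
    field
      commutativeRing : CommutativeRing 0ℓ 0ℓ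

    open CommutativeRing commutativeRing using (Carrier; _≈_; _*_; 0#; 1#; setoid)

    field
      1≉0         : ¬ 1# ≈ 0#
      inverse     : ∀ x → ¬ x ≈ 0# → ∃ λ y → x * y ≈ 1#
      enumeration : Inverse (≡.setoid (Fin q)) setoid

  module Subspaces {q : ℕ} (F : FiniteField q) (V : Module (FiniteField.commutativeRing F) 0ℓ 0ℓ) where

    open FiniteField F
    open CommutativeRing commutativeRing
      using (Carrier; _≈_; _+_; _*_; -_; 0#; 1#; -‿inverseʳ; +-congˡ; *-comm; trans; sym; reflexive)
    open Module V
    open Algebra.Properties.Monoid.Sum +ᴹ-monoid using (sum; sum-cong-≋)

    lincomb : ∀ {k} → (Fin k → Carrier) → (Fin k → Carrierᴹ) → Carrierᴹ
    lincomb c b = sum (λ j → c j *ₗ b j)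

    LinearlyIndependent : ∀ {k} → (Fin k → Carrierᴹ) → Set
    LinearlyIndependent b = ∀ c → lincomb c b ≈ᴹ 0ᴹ → ∀ j → c j ≈ 0#

    record LinearSubspace : Set where
      field
        mem     : Carrierᴹ → Bool
        ∈-resp  : ∀ {u v} → u ≈ᴹ v → T (mem u) → T (mem v)
        0∈      : T (mem 0ᴹ)
        +∈      : ∀ {u v} → T (mem u) → T (mem v) → T (mem (u +ᴹ v))
        *∈      : ∀ a {v} → T (mem v) → T (mem (a *ₗ v))

    infix 4 _∈_ _⊆_
    _∈_ : Carrierᴹ → LinearSubspace → Set
    v ∈ U = T (LinearSubspace.mem U v)

    _⊆_ : LinearSubspace → LinearSubspace → Set
    U ⊆ W = ∀ v → v ∈ U → v ∈ W

    record IsBasis (U : LinearSubspace) {k} (b : Fin k → Carrierᴹ) : Set where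
      field
        independent : LinearlyIndependent b
        spans       : ∀ v → v ∈ U ⇔ (∃ λ c → lincomb c b ≈ᴹ v)

    HasDim : LinearSubspace → ℕ → Set
    HasDim U k = ∃ λ b → IsBasis U {k} b

    whole : LinearSubspace
    whole = record { mem = λ _ → true ; ∈-resp = λ _ _ → tt ; 0∈ = tt ; +∈ = λ _ _ → tt ; *∈ = λ _ _ → tt }

    open Inverse enumeration using () renaming (to to elem; from to index; from-cong to index-cong; strictlyInverseˡ to elem-index; strictlyInverseʳ to index-elem)

    index-injective : ∀ {x y} → index x ≡ index y → x ≈ y
    index-injective {x} {y} p = trans (sym (elem-index x)) (trans (reflexive (≡.cong elem p)) (elem-index y))

    _≟_ : Decidable _≈_
    x ≟ y = map′ index-injective index-cong (index x Fin.≟ index y)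

    1<q : 1 ℕ.< q
    1<q = injective⇒≤ {f = f} λ {i} {j} → f-inj i j
      where
      f : Fin 2 → Fin q
      f zero    = index 0#
      f (suc _) = index 1#
      f-inj : ∀ i j → f i ≡ f j → i ≡ j
      f-inj zero       zero       _ = refl
      f-inj zero       (suc zero) p = ⊥-elim (1≉0 (sym (index-injective p)))
      f-inj (suc zero) zero       p = ⊥-elim (1≉0 (index-injective p))
      f-inj (suc zero) (suc zero) _ = refl

    funToFin-cong : ∀ {m k} {f g : Fin m → Fin k} → f ≗ g → funToFin f ≡ funToFin g
    funToFin-cong {zero}  p = refl
    funToFin-cong {suc m} p = ≡.cong₂ combine (p zero) (funToFin-cong (p ∘ suc))

    decode : ∀ k → Fin (q ^ k) → Fin k → Carrier
    decode k i j = elem (finToFun i j)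

    encode : ∀ {k} → (Fin k → Carrier) → Fin (q ^ k)
    encode c = funToFin (index ∘ c)

    decode-encode : ∀ {k} (c : Fin k → Carrier) j → decode k (encode c) j ≈ c j
    decode-encode c j = trans (reflexive (≡.cong elem (finToFun-funToFin (index ∘ c) j))) (elem-index (c j))

    decode-injective : ∀ k {i i′ : Fin (q ^ k)} → (∀ j → decode k i j ≈ decode k i′ j) → i ≡ i′
    decode-injective k {i} {i′} p =
      ≡.trans (≡.sym (funToFin-finToFin {k} {q} i))
      (≡.trans (funToFin-cong {k} λ j → ≡.trans (≡.sym (index-elem (finToFun i j)))
                                 (≡.trans (index-cong (p j)) (index-elem (finToFun i′ j))))
               (funToFin-finToFin {k} {q} i′))

    open Relation.Binary.Reasoning.Setoid ≈ᴹ-setoid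

    lincomb-cong : ∀ {k} {c d : Fin k → Carrier} {b} → (∀ j → c j ≈ d j) → lincomb c b ≈ᴹ lincomb d b
    lincomb-cong p = sum-cong-≋ λ j → *ₗ-cong (p j) ≈ᴹ-refl

    interchange : ∀ u v w x → (u +ᴹ v) +ᴹ (w +ᴹ x) ≈ᴹ (u +ᴹ w) +ᴹ (v +ᴹ x)
    interchange u v w x = begin
      (u +ᴹ v) +ᴹ (w +ᴹ x)   ≈⟨ +ᴹ-assoc u v (w +ᴹ x) ⟩
      u +ᴹ (v +ᴹ (w +ᴹ x))   ≈⟨ +ᴹ-congˡ (+ᴹ-assoc v w x) ⟨
      u +ᴹ ((v +ᴹ w) +ᴹ x)   ≈⟨ +ᴹ-congˡ (+ᴹ-congʳ (+ᴹ-comm v w)) ⟩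
      u +ᴹ ((w +ᴹ v) +ᴹ x)   ≈⟨ +ᴹ-congˡ (+ᴹ-assoc w v x) ⟩
      u +ᴹ (w +ᴹ (v +ᴹ x))   ≈⟨ +ᴹ-assoc u w (v +ᴹ x) ⟨
      (u +ᴹ w) +ᴹ (v +ᴹ x)   ∎

    lincomb-+ : ∀ {k} (c d : Fin k → Carrier) b →
                lincomb (λ j → c j + d j) b ≈ᴹ lincomb c b +ᴹ lincomb d b
    lincomb-+ {zero}  c d b = ≈ᴹ-sym (+ᴹ-identityˡ 0ᴹ)
    lincomb-+ {suc k} c d b = begin
      (c zero + d zero) *ₗ b zero +ᴹ lincomb (λ j → c (suc j) + d (suc j)) (b ∘ suc)
        ≈⟨ +ᴹ-cong (*ₗ-distribʳ (b zero) (c zero) (d zero)) (lincomb-+ (c ∘ suc) (d ∘ suc) (b ∘ suc)) ⟩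
      (c zero *ₗ b zero +ᴹ d zero *ₗ b zero) +ᴹ (lincomb (c ∘ suc) (b ∘ suc) +ᴹ lincomb (d ∘ suc) (b ∘ suc))
        ≈⟨ interchange _ _ _ _ ⟩
      lincomb c b +ᴹ lincomb d b ∎

    lincomb-* : ∀ {k} a (c : Fin k → Carrier) b → lincomb (λ j → a * c j) b ≈ᴹ a *ₗ lincomb c b
    lincomb-* {zero}  a c b = ≈ᴹ-sym (*ₗ-zeroʳ a)
    lincomb-* {suc k} a c b = begin
      (a * c zero) *ₗ b zero +ᴹ lincomb (λ j → a * c (suc j)) (b ∘ suc)
        ≈⟨ +ᴹ-cong (*ₗ-assoc a (c zero) (b zero)) (lincomb-* a (c ∘ suc) (b ∘ suc)) ⟩
      a *ₗ (c zero *ₗ b zero) +ᴹ a *ₗ lincomb (c ∘ suc) (b ∘ suc)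
        ≈⟨ *ₗ-distribˡ a _ _ ⟨
      a *ₗ lincomb c b ∎

    lincomb-0 : ∀ {k} (b : Fin k → Carrierᴹ) → lincomb (const 0#) b ≈ᴹ 0ᴹ
    lincomb-0 {zero}  b = ≈ᴹ-refl
    lincomb-0 {suc k} b = ≈ᴹ-trans (+ᴹ-cong (*ₗ-zeroˡ (b zero)) (lincomb-0 (b ∘ suc))) (+ᴹ-identityˡ 0ᴹ)

    lincomb-∈ : ∀ {k} U (c : Fin k → Carrier) b → (∀ j → b j ∈ U) → lincomb c b ∈ U
    lincomb-∈ {zero}  U c b b∈U = LinearSubspace.0∈ U
    lincomb-∈ {suc k} U c b b∈U =
      LinearSubspace.+∈ U (LinearSubspace.*∈ U (c zero) (b∈U zero)) (lincomb-∈ U (c ∘ suc) (b ∘ suc) (b∈U ∘ suc))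

    cancel : ∀ v → v +ᴹ (- 1#) *ₗ v ≈ᴹ 0ᴹ
    cancel v = begin
      v +ᴹ (- 1#) *ₗ v         ≈⟨ +ᴹ-congʳ (*ₗ-identityˡ v) ⟨
      1# *ₗ v +ᴹ (- 1#) *ₗ v   ≈⟨ *ₗ-distribʳ v 1# (- 1#) ⟨
      (1# + - 1#) *ₗ v         ≈⟨ *ₗ-cong (-‿inverseʳ 1#) ≈ᴹ-refl ⟩
      0# *ₗ v                  ≈⟨ *ₗ-zeroˡ v ⟩
      0ᴹ                       ∎

    unique-coefficients : ∀ {k} {b : Fin k → Carrierᴹ} → LinearlyIndependent b → ∀ c d →
                          lincomb c b ≈ᴹ lincomb d b → ∀ j → c j ≈ d j
    unique-coefficients {b = b} ind c d p j = F.x∙y⁻¹≈ε⇒x≈y (c j) (d j)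
      (trans (+-congˡ (sym (R.-1*x≈-x (d j)))) (ind (λ j → c j + (- 1#) * d j) (begin
        lincomb (λ j → c j + (- 1#) * d j) b              ≈⟨ lincomb-+ c (λ j → (- 1#) * d j) b ⟩
        lincomb c b +ᴹ lincomb (λ j → (- 1#) * d j) b     ≈⟨ +ᴹ-cong p (lincomb-* (- 1#) d b) ⟩
        lincomb d b +ᴹ (- 1#) *ₗ lincomb d b              ≈⟨ cancel (lincomb d b) ⟩
        0ᴹ                                               ∎) j))
      where
      module F = Algebra.Properties.Group (CommutativeRing.+-group commutativeRing)
      module R = Algebra.Properties.Ring (CommutativeRing.ring commutativeRing)

    basis-∈ : ∀ {U k} {b : Fin k → Carrierᴹ} → IsBasis U b → ∀ j → b j ∈ U
    basis-∈ {b = b} B j = Equivalence.from (IsBasis.spans B (b j)) (δ j , lincomb-δ j b)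
      where
      δ : ∀ {k} → Fin k → Fin k → Carrier
      δ zero    zero    = 1#
      δ zero    (suc _) = 0#
      δ (suc _) zero    = 0#
      δ (suc i) (suc j) = δ i j
      lincomb-δ : ∀ {k} (i : Fin k) b → lincomb (δ i) b ≈ᴹ b i
      lincomb-δ zero    b = ≈ᴹ-trans (+ᴹ-cong (*ₗ-identityˡ (b zero)) (lincomb-0 (b ∘ suc))) (+ᴹ-identityʳ (b zero))
      lincomb-δ (suc i) b = ≈ᴹ-trans (+ᴹ-cong (*ₗ-zeroˡ (b zero)) (lincomb-δ i (b ∘ suc))) (+ᴹ-identityˡ (b (suc i)))

    independent⇒≤ : ∀ {W a d} {b : Fin a → Carrierᴹ} → LinearlyIndependent b → (∀ j → b j ∈ W) →
                    HasDim W d → a ℕ.≤ d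
    independent⇒≤ {W} {a} {d} {b} ind b∈W (w , B) = ℕ.≮⇒≥ λ d<a →
      ℕ.<⇒≱ (ℕ.^-monoʳ-< q 1<q d<a) (injective⇒≤ code-injective)
      where
      coords : ∀ i → ∃ λ c → lincomb c w ≈ᴹ lincomb (decode a i) b
      coords i = Equivalence.to (IsBasis.spans B _) (lincomb-∈ W (decode a i) b b∈W)
      code : Fin (q ^ a) → Fin (q ^ d)
      code i = encode (proj₁ (coords i))
      code-injective : Injective _≡_ _≡_ code
      code-injective {i} {i′} p = decode-injective a (unique-coefficients ind (decode a i) (decode a i′) (begin
        lincomb (decode a i) b               ≈⟨ proj₂ (coords i) ⟨
        lincomb (proj₁ (coords i)) w       ≈⟨ lincomb-cong (decode-encode (proj₁ (coords i))) ⟨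
        lincomb (decode d (code i)) w        ≡⟨ ≡.cong (λ z → lincomb (decode d z) w) p ⟩
        lincomb (decode d (code i′)) w       ≈⟨ lincomb-cong (decode-encode (proj₁ (coords i′))) ⟩
        lincomb (proj₁ (coords i′)) w      ≈⟨ proj₂ (coords i′) ⟩
        lincomb (decode a i′) b              ∎))

    infixr 5 _◂_
    _◂_ : ∀ {k} → Carrierᴹ → (Fin k → Carrierᴹ) → Fin (suc k) → Carrierᴹ
    (x ◂ b) zero    = x
    (x ◂ b) (suc j) = b j

    ◂-independent : ∀ {U k x} {b : Fin k → Carrierᴹ} → LinearlyIndependent b → (∀ j → b j ∈ U) →
                    ¬ x ∈ U → LinearlyIndependent (x ◂ b)
    ◂-independent {U} {x = x} {b} ind b∈U x∉U c p with c zero ≟ 0#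
    ... | yes c₀≈0 = λ where
        zero    → c₀≈0
        (suc j) → ind (c ∘ suc) (begin
          lincomb (c ∘ suc) b                   ≈⟨ +ᴹ-identityˡ _ ⟨
          0ᴹ +ᴹ lincomb (c ∘ suc) b             ≈⟨ +ᴹ-congʳ (*ₗ-zeroˡ x) ⟨
          0# *ₗ x +ᴹ lincomb (c ∘ suc) b        ≈⟨ +ᴹ-congʳ (*ₗ-cong c₀≈0 ≈ᴹ-refl) ⟨
          c zero *ₗ x +ᴹ lincomb (c ∘ suc) b    ≈⟨ p ⟩
          0ᴹ                                    ∎) j
    ... | no c₀≉0 = ⊥-elim (x∉U (∈-resp (≈ᴹ-sym x≈) (*∈ (- 1#) (*∈ a (lincomb-∈ U (c ∘ suc) b b∈U)))))
      where
      open LinearSubspace U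
      a = proj₁ (inverse (c zero) c₀≉0)
      l = lincomb (c ∘ suc) b
      x+al≈0 : x +ᴹ a *ₗ l ≈ᴹ 0ᴹ
      x+al≈0 = begin
        x +ᴹ a *ₗ l                     ≈⟨ +ᴹ-congʳ (*ₗ-identityˡ x) ⟨
        1# *ₗ x +ᴹ a *ₗ l               ≈⟨ +ᴹ-congʳ (*ₗ-cong (proj₂ (inverse (c zero) c₀≉0)) ≈ᴹ-refl) ⟨
        (c zero * a) *ₗ x +ᴹ a *ₗ l     ≈⟨ +ᴹ-congʳ (*ₗ-cong (*-comm (c zero) a) ≈ᴹ-refl) ⟩
        (a * c zero) *ₗ x +ᴹ a *ₗ l     ≈⟨ +ᴹ-congʳ (*ₗ-assoc a (c zero) x) ⟩
        a *ₗ (c zero *ₗ x) +ᴹ a *ₗ l    ≈⟨ *ₗ-distribˡ a (c zero *ₗ x) l ⟨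
        a *ₗ (c zero *ₗ x +ᴹ l)         ≈⟨ *ₗ-congˡ p ⟩
        a *ₗ 0ᴹ                         ≈⟨ *ₗ-zeroʳ a ⟩
        0ᴹ                              ∎
      x≈ : x ≈ᴹ (- 1#) *ₗ (a *ₗ l)
      x≈ = begin
        x                                          ≈⟨ +ᴹ-identityʳ x ⟨
        x +ᴹ 0ᴹ                                    ≈⟨ +ᴹ-congˡ (cancel (a *ₗ l)) ⟨
        x +ᴹ (a *ₗ l +ᴹ (- 1#) *ₗ (a *ₗ l))        ≈⟨ +ᴹ-assoc _ _ _ ⟨
        (x +ᴹ a *ₗ l) +ᴹ (- 1#) *ₗ (a *ₗ l)        ≈⟨ +ᴹ-congʳ x+al≈0 ⟩
        0ᴹ +ᴹ (- 1#) *ₗ (a *ₗ l)                   ≈⟨ +ᴹ-identityˡ _ ⟩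
        (- 1#) *ₗ (a *ₗ l)                         ∎

    dim-cong : ∀ {U W k} → U ⊆ W → W ⊆ U → HasDim U k → HasDim W k
    dim-cong U⊆W W⊆U (b , B) = b , record
      { independent = IsBasis.independent B
      ; spans       = λ v → mk⇔ (Equivalence.to (IsBasis.spans B v) ∘ W⊆U v)
                                (U⊆W v ∘ Equivalence.from (IsBasis.spans B v))
      }

    dim-mono : ∀ {U W a d} → HasDim U a → HasDim W d → U ⊆ W → a ℕ.≤ d
    dim-mono {U} {W} (b , B) s U⊆W =
      independent⇒≤ {W} (IsBasis.independent B) (λ j → U⊆W (b j) (basis-∈ {U} B j)) s

    module _ {n : ℕ} (V-dim : HasDim whole n) where
      e = proj₁ V-dim
      module E = IsBasis (proj₂ V-dim)

      vec : Fin (q ^ n) → Carrierᴹ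
      vec i = lincomb (decode n i) e

      vec-surjective : ∀ v → ∃ λ i → vec i ≈ᴹ v
      vec-surjective v with c , p ← Equivalence.to (E.spans v) tt =
        encode c , ≈ᴹ-trans (lincomb-cong (decode-encode c)) p

      abstract
        _≟ᴹ_ : Decidable _≈ᴹ_
        u ≟ᴹ v with c , p ← Equivalence.to (E.spans u) tt | d , r ← Equivalence.to (E.spans v) tt =
          map′ (λ h → ≈ᴹ-trans (≈ᴹ-sym p) (≈ᴹ-trans (lincomb-cong h) r))
               (λ h → unique-coefficients E.independent c d (≈ᴹ-trans p (≈ᴹ-trans h (≈ᴹ-sym r))))
               (all? λ j → c j ≟ d j)

      ⊆-at? : ∀ U W i → Dec (vec i ∈ U → vec i ∈ W)
      ⊆-at? U W i = T? (LinearSubspace.mem U (vec i)) →-dec T? (LinearSubspace.mem W (vec i))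

      ⊆-from : ∀ U W → (∀ i → vec i ∈ U → vec i ∈ W) → U ⊆ W
      ⊆-from U W h v v∈U with i , p ← vec-surjective v =
        LinearSubspace.∈-resp W p (h i (LinearSubspace.∈-resp U (≈ᴹ-sym p) v∈U))

      witness : ∀ {U W} → ¬ U ⊆ W → ∃ λ x → x ∈ U × ¬ x ∈ W
      witness {U} {W} U⊈W with i , h ← ¬∀⟶∃¬ (q ^ n) _ (⊆-at? U W) (U⊈W ∘ ⊆-from U W) =
        vec i , decidable-stable (T? (LinearSubspace.mem U (vec i))) (λ ¬u → h (⊥-elim ∘ ¬u)) , λ w → h λ _ → w

      dim-< : ∀ {U W a d} → HasDim U a → HasDim W d → U ⊆ W → ¬ W ⊆ U → a ℕ.< d
      dim-< {U} {W} (b , B) s U⊆W W⊈U with x , x∈W , x∉U ← witness {W} {U} W⊈U =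
        independent⇒≤ {W} {b = x ◂ b} (◂-independent {U} (IsBasis.independent B) (basis-∈ {U} B) x∉U)
          (λ { zero → x∈W ; (suc j) → U⊆W (b j) (basis-∈ {U} B j) }) s

      inSpan? : ∀ {k} (b : Fin k → Carrierᴹ) v → Dec (∃ λ c → lincomb c b ≈ᴹ v)
      inSpan? {k} b v = map′
        (λ (i , p) → decode k i , p)
        (λ (c , p) → encode c , ≈ᴹ-trans (lincomb-cong (decode-encode c)) p)
        (any? λ i → lincomb (decode k i) b ≟ᴹ v)

      module _ {k} (b : Fin k → Carrierᴹ) where
        to-span : ∀ {v} → (∃ λ c → lincomb c b ≈ᴹ v) → T ⌊ inSpan? b v ⌋
        to-span {v} = fromWitness {a? = inSpan? b v}

        from-span : ∀ {v} → T ⌊ inSpan? b v ⌋ → ∃ λ c → lincomb c b ≈ᴹ v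
        from-span {v} = toWitness {a? = inSpan? b v}

        span : LinearSubspace
        span = record
          { mem    = λ v → ⌊ inSpan? b v ⌋
          ; ∈-resp = λ u≈v u∈ → let c , p = from-span u∈ in to-span (c , ≈ᴹ-trans p u≈v)
          ; 0∈     = to-span (const 0# , lincomb-0 b)
          ; +∈     = λ u∈ v∈ → let c , p = from-span u∈ ; d , r = from-span v∈ in
                       to-span ((λ j → c j + d j) , ≈ᴹ-trans (lincomb-+ c d b) (+ᴹ-cong p r))
          ; *∈     = λ a v∈ → let c , p = from-span v∈ in
                       to-span ((λ j → a * c j) , ≈ᴹ-trans (lincomb-* a c b) (*ₗ-congˡ p))
          }

        span-basis : LinearlyIndependent b → IsBasis span b
        span-basis ind = record { independent = ind ; spans = λ v → mk⇔ from-span to-span }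

        span-⊆ : ∀ W → (∀ j → b j ∈ W) → span ⊆ W
        span-⊆ W b∈W v v∈ = let c , p = from-span v∈ in
          LinearSubspace.∈-resp W p (lincomb-∈ W c b b∈W)

      extend : ∀ {U W a} → HasDim U a → U ⊆ W → ¬ W ⊆ U →
               ∃ λ U′ → HasDim U′ (suc a) × U ⊆ U′ × U′ ⊆ W × ¬ U′ ⊆ U
      extend {U} {W} {a} (b , B) U⊆W W⊈U = span b′ , (b′ , B′) , U⊆ , span-⊆ b′ W b′∈W ,
        λ h → x∉U (h x (basis-∈ {span b′} B′ zero))
        where
        x = proj₁ (witness {W} {U} W⊈U)
        x∈W = proj₁ (proj₂ (witness {W} {U} W⊈U))
        x∉U = proj₂ (proj₂ (witness {W} {U} W⊈U))
        b′ : Fin (suc a) → Carrierᴹ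
        b′ = x ◂ b
        B′ : IsBasis (span b′) b′
        B′ = span-basis b′ (◂-independent {U} (IsBasis.independent B) (basis-∈ {U} B) x∉U)
        U⊆ : U ⊆ span b′
        U⊆ v v∈U = let c , p = Equivalence.to (IsBasis.spans B v) v∈U in
          to-span b′ ( (λ { zero → 0# ; (suc j) → c j })
                     , ≈ᴹ-trans (+ᴹ-congʳ (*ₗ-zeroˡ x)) (≈ᴹ-trans (+ᴹ-identityˡ (lincomb c b)) p))
        b′∈W : ∀ j → b′ j ∈ W
        b′∈W zero    = x∈W
        b′∈W (suc j) = U⊆W (b j) (basis-∈ {U} B j)

      subspaceLattice : RankedLattice n
      subspaceLattice = record
        { Subspace  = LinearSubspace
        ; _≤_       = _⊆_
        ; HasRank   = HasDim
        ; ≤-refl    = λ _ p → p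
        ; ≤-trans   = λ p r v → r v ∘ p v
        ; _≤?_      = λ U W → map′ (⊆-from U W) (λ h i → h (vec i)) (all? (⊆-at? U W))
        ; bottom    = span none , (none , span-basis none λ _ _ ()) , λ W → span-⊆ none W λ ()
        ; top       = whole , V-dim , λ _ _ _ → tt
        ; rank-cong = λ {U} {W} → dim-cong {U} {W}
        ; rank-mono = λ {U} {W} → dim-mono {U} {W}
        ; rank-<    = λ {U} {W} → dim-< {U} {W}
        ; extend    = λ {U} {W} → extend {U} {W}
        }
        where
        none : Fin 0 → Carrierᴹ
        none ()

open VectorSpaces public

open import Algebra.Module.Bundles using (Module)
open import Data.Fin.Base using (Fin)
open import Data.Nat.Base using (ℕ)
open import Function.Bundles using (_↔_)
open import Level using (0ℓ)

-- A finite set (q = 1) or a finite-dimensional vector space over a field with q elements,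
-- of rank n.
data Space (n : ℕ) : Set₁ where
  finiteSet   : (V : Set) → Fin n ↔ V → Space n
  vectorSpace : ∀ {q} (F : FiniteField q) (V : Module (FiniteField.commutativeRing F) 0ℓ 0ℓ) →
                Subspaces.HasDim F V (Subspaces.whole F V) n → Space n

lattice : ∀ {n} → Space n → RankedLattice n
lattice (finiteSet V V-finite)  = Subsets.subsetLattice V-finite
lattice (vectorSpace F V V-dim) = Subspaces.subspaceLattice F V V-dim

{-# OPTIONS --safe #-}
-- Dualizing turns χ U into the indicator of K ≤ J, where J = U^⊥ has corank i, so it suffices to write this
-- indicator, on the flats K of rank m ≥ i, as a combination of indicators of I ≤ K with I of rank i. This is
-- done by induction on i. If J′ covers J, then a flat K ≤ J′ not below J has the same number κ of points
-- outside J, whence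
--   κ ([K ≤ J′] − [K ≤ J]) = Σ_{x ∉ J} [x ∈ K] [K ≤ J′].
-- On the right, [x ∈ K] [I ≤ K] = [I ∨ x ≤ K], and I ∨ x has rank i + 1 unless x ∈ I; in that case the rank
-- is raised by counting the points of K outside I, which gives Σ_{x ∉ I} [I ∨ x ≤ K] = κ′ [I ≤ K].

module Submission where

open import Defs
open import Algebra.Bundles using (CommutativeRing)
open import Algebra.Module.Bundles using (Module)
import Algebra.Properties.CommutativeSemigroup
import Algebra.Properties.Group
import Algebra.Properties.Monoid.Mult
import Algebra.Properties.Monoid.Sum
import Algebra.Properties.Ring
import Algebra.Properties.Semiring.Sum
open import Data.Bool.Base using (if_then_else_; T; _∧_)
open import Data.Bool.Properties using (T?; T-∧; T-∨)
open import Data.Empty using (⊥-elim)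
open import Data.Fin.Base using (Fin; zero; suc; punchIn)
import Data.Fin.Properties as Fin
open import Data.Nat.Base using (ℕ; zero; suc; s≤s; _≤_; _<_; _⊓_; _∸_; _^_) renaming (_+_ to _ℕ+_)
import Data.Nat.Properties as ℕ
open import Data.Product.Base using (_×_; _,_; ∃; ∃₂; Σ; proj₁; proj₂)
import Data.Rational.Base as ℚ
import Data.Rational.Properties as ℚ
open import Data.Sum.Base using (inj₂; map₂)
open import Data.Vec.Functional using (_∷_; removeAt)
open import Function.Base using (_∘_)
open import Function.Bundles using (_⇔_; _↔_; Equivalence; Func; Inverse; mk⇔)
open import Function.Definitions using (Injective)
open import Level using (0ℓ)
open import Relation.Binary.Bundles using (Setoid)
open import Relation.Binary.PropositionalEquality as ≡ using (_≡_; _≢_; refl)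
import Relation.Binary.Reasoning.Setoid
open import Relation.Nullary.Construct.Add.Infimum using (_₋; ⊥₋; [_])
open import Relation.Nullary.Decidable.Core using (Dec; yes; no; does; _×-dec_; ¬?)
open import Relation.Nullary.Negation.Core using (¬_)
open import Relation.Unary using (_≐_)

-- Ranked lattices whose flats are sets of points.

-- The points are the elements of a set, or all the vectors of a vector space, so that a subspace of rank a
-- has size a = a or size a = q ^ a points.
record PointStructure {n} (L : RankedLattice n) : Set₁ where
  open RankedLattice L using (Subspace; HasRank) renaming (_≤_ to _⊑_)
  infix  4 _∈_ _∈?_
  infixl 6 _∨_
  infixl 7 _∩_
  field
    points : ℕ
    _∈_    : Fin points → Subspace → Set
    _∈?_   : ∀ x U → Dec (x ∈ U)

    ∈-mono   : ∀ {U W x} → U ⊑ W → x ∈ U → x ∈ W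
    separate : ∀ {U W} → ¬ U ⊑ W → ∃ λ x → x ∈ U × ¬ x ∈ W

    _∨_     : Subspace → Fin points → Subspace
    ⊑∨      : ∀ U x → U ⊑ U ∨ x
    ∈∨      : ∀ U x → x ∈ U ∨ x
    ∨-least : ∀ {U W x} → U ⊑ W → x ∈ W → U ∨ x ⊑ W
    ∨-rank  : ∀ {U x a} → HasRank U a → ¬ x ∈ U → HasRank (U ∨ x) (suc a)

    _∩_  : Subspace → Subspace → Subspace
    ∩⊑ˡ  : ∀ U W → U ∩ W ⊑ U
    ∩⊑ʳ  : ∀ U W → U ∩ W ⊑ W
    ∈∩   : ∀ {U W x} → x ∈ U → x ∈ W → x ∈ U ∩ W
    -- The half `U ∩ (W ∨ w) ⊑ (U ∩ W) ∨ w` of the modular law for `w ∈ U`, read pointwise. It fixes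
    -- the rank of an intersection with a hyperplane in `∩-rank`.
    modular : ∀ {U W w x} → w ∈ U → x ∈ U → x ∈ W ∨ w → x ∈ (U ∩ W) ∨ w

    size        : ℕ → ℕ
    size-mono-< : ∀ {a b} → a < b → size a < size b
    enumerate   : ∀ {U a} → HasRank U a → ∃ λ (e : Fin (size a) → Fin points) →
                  Injective _≡_ _≡_ e × (∀ t → e t ∈ U) × (∀ {x} → x ∈ U → ∃ λ t → e t ≡ x)

-- Sums of indicators over a commutative ring.

module Indicators (R : CommutativeRing 0ℓ 0ℓ) where
  open CommutativeRing R hiding (zero) renaming (refl to ≈-refl)
  open Algebra.Properties.Monoid.Sum +-monoid public using (sum)
  open Algebra.Properties.Semiring.Sum semiring public hiding (sum)
  open Algebra.Properties.Monoid.Mult +-monoid public using (×-homo-+) renaming (_×_ to _·_)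
  open Relation.Binary.Reasoning.Setoid setoid

  -- What the argument demands of the reals besides the ring axioms: point counts have to be divided
  -- out.
  PositivesInvertible : Set
  PositivesInvertible = ∀ d → 0 < d → ∃ λ r → r * (d · 1#) ≈ 1#

  𝟙 : {P : Set} → Dec P → Carrier
  𝟙 P? = if does P? then 1# else 0#

  𝟙-yes : {P : Set} (P? : Dec P) → P → 𝟙 P? ≈ 1#
  𝟙-yes (yes _) _ = ≈-refl
  𝟙-yes (no ¬p) p = ⊥-elim (¬p p)

  𝟙-no : {P : Set} (P? : Dec P) → ¬ P → 𝟙 P? ≈ 0#
  𝟙-no (yes p) ¬p = ⊥-elim (¬p p)
  𝟙-no (no _)  _  = ≈-refl

  𝟙-cong : {P Q : Set} (P? : Dec P) (Q? : Dec Q) → (P → Q) → (Q → P) → 𝟙 P? ≈ 𝟙 Q?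
  𝟙-cong (yes p) Q? f g = sym (𝟙-yes Q? (f p))
  𝟙-cong (no ¬p) Q? f g = sym (𝟙-no Q? (¬p ∘ g))

  sum-zero : ∀ {n} {f : Fin n → Carrier} → (∀ j → f j ≈ 0#) → sum f ≈ 0#
  sum-zero {n} f≈0 = trans (sum-cong-≋ f≈0) (sum-replicate-zero n)

  sum-single : ∀ {n} {f : Fin n → Carrier} i → (∀ j → j ≢ i → f j ≈ 0#) → sum f ≈ f i
  sum-single {suc n} {f} i f≈0 = begin
    sum f                      ≈⟨ sum-remove {i = i} f ⟩
    f i + sum (removeAt f i)   ≈⟨ +-congˡ (sum-zero λ j → f≈0 (punchIn i j) (Fin.punchInᵢ≢i i j)) ⟩
    f i + 0#                   ≈⟨ +-identityʳ (f i) ⟩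
    f i                        ∎

  -- Each point satisfying `P` is `e t` for exactly one `t`, so its indicator is the sum over `t` of
  -- the indicators of `x ≡ e t`. Exchanging the two sums counts the `t`.
  sum-𝟙 : ∀ {a n} {P : Fin n → Set} (P? : ∀ x → Dec (P x)) (e : Fin a → Fin n) → Injective _≡_ _≡_ e →
          (∀ t → P (e t)) → (∀ {x} → P x → ∃ λ t → e t ≡ x) → sum (λ x → 𝟙 (P? x)) ≈ a · 1#
  sum-𝟙 {a} P? e e-inj e-P e-surj = begin
    sum (λ x → 𝟙 (P? x))                            ≈⟨ sum-cong-≋ fibre ⟩
    sum (λ x → sum (λ t → 𝟙 (x Fin.≟ e t)))         ≈⟨ ∑-comm (λ x t → 𝟙 (x Fin.≟ e t)) ⟩
    sum (λ t → sum (λ x → 𝟙 (x Fin.≟ e t)))         ≈⟨ sum-cong-≋ point ⟩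
    sum (λ (_ : Fin a) → 1#)                        ≈⟨ sum-replicate a ⟩
    a · 1#                                          ∎
    where
    point : ∀ t → sum (λ x → 𝟙 (x Fin.≟ e t)) ≈ 1#
    point t = trans (sum-single (e t) (λ x → 𝟙-no (x Fin.≟ e t))) (𝟙-yes (e t Fin.≟ e t) refl)
    fibre : ∀ x → 𝟙 (P? x) ≈ sum (λ t → 𝟙 (x Fin.≟ e t))
    fibre x with P? x
    ... | no ¬p = sym (sum-zero λ t → 𝟙-no (x Fin.≟ e t) λ { refl → ¬p (e-P t) })
    ... | yes p with t , refl ← e-surj p = sym (trans
      (sum-single t λ s s≢t → 𝟙-no (e t Fin.≟ e s) (s≢t ∘ ≡.sym ∘ e-inj))
      (𝟙-yes (e t Fin.≟ e t) refl))

-- Linear spans of families of functions.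

module Spans (R : CommutativeRing 0ℓ 0ℓ) {X Y : Set} (x : X → Y → CommutativeRing.Carrier R) where
  open CommutativeRing R hiding (zero) renaming (refl to ≈-refl)
  open Indicators R
  open Relation.Binary.Reasoning.Setoid setoid

  -- Matches `Span`, but for bare functions, so that closure properties carry no proofs that a
  -- function respects equality of subspaces.
  InSpan : (Y → Carrier) → Set
  InSpan f = ∃ λ m → ∃₂ λ (c : Fin m → Carrier) (I : Fin m → X) → ∀ K → f K ≈ sum (λ j → c j * x (I j) K)

  span-cong : ∀ {f g} → (∀ K → g K ≈ f K) → InSpan f → InSpan g
  span-cong g≈f (m , c , I , p) = m , c , I , λ K → trans (g≈f K) (p K)

  span-0 : InSpan (λ _ → 0#)
  span-0 = 0 , (λ ()) , (λ ()) , λ _ → ≈-refl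

  span-gen : ∀ I → InSpan (x I)
  span-gen I = 1 , (λ _ → 1#) , (λ _ → I) , λ K → sym (trans (+-identityʳ _) (*-identityˡ _))

  span-+ : ∀ {f g} → InSpan f → InSpan g → InSpan (λ K → f K + g K)
  span-+ {g = g} (m , c , I , p) g∈ = span-cong (λ K → +-congʳ (p K)) (append m c I)
    where
    append : ∀ m (c : Fin m → Carrier) (I : Fin m → X) → InSpan (λ K → sum (λ j → c j * x (I j) K) + g K)
    append zero    c I = span-cong (λ K → +-identityˡ (g K)) g∈
    append (suc m) c I with m′ , c′ , I′ , p′ ← append m (c ∘ suc) (I ∘ suc) =
      suc m′ , c zero ∷ c′ , I zero ∷ I′ , λ K → trans (+-assoc _ _ _) (+-congˡ (p′ K))

  span-* : ∀ {f} a → InSpan f → InSpan (λ K → a * f K)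
  span-* {f} a (m , c , I , p) = m , (λ j → a * c j) , I , λ K → begin
    a * f K                               ≈⟨ *-congˡ (p K) ⟩
    a * sum (λ j → c j * x (I j) K)       ≈⟨ *-distribˡ-sum a (λ j → c j * x (I j) K) ⟩
    sum (λ j → a * (c j * x (I j) K))     ≈⟨ sum-cong-≋ (λ j → *-assoc a (c j) (x (I j) K)) ⟨
    sum (λ j → a * c j * x (I j) K)       ∎

  span-sum : ∀ {m} {f : Fin m → Y → Carrier} → (∀ j → InSpan (f j)) → InSpan (λ K → sum (λ j → f j K))
  span-sum {zero}  f∈ = span-0
  span-sum {suc m} f∈ = span-+ (f∈ zero) (span-sum (f∈ ∘ suc))

-- Counting points and raising the rank of generators.

module Degrees (R : CommutativeRing 0ℓ 0ℓ)
  (·-invertible : Indicators.PositivesInvertible R)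
  {n} {L : RankedLattice n} (P : PointStructure L) where

  open CommutativeRing R hiding (zero) renaming (refl to ≈-refl)
  open Indicators R
  open Relation.Binary.Reasoning.Setoid setoid
  open Algebra.Properties.Ring ring using (-1*x≈-x)
  open Algebra.Properties.CommutativeSemigroup *-commutativeSemigroup using (x∙yz≈y∙xz)
  open Algebra.Properties.Group +-group using (∙-cancelʳ; x≈z//y)

  open RankedLattice L renaming (_≤_ to _⊑_; _≤?_ to _⊑?_; ≤-trans to ⊑-trans) hiding (_≈_)
  open PointStructure P

  Flat : ℕ → Set
  Flat i = Σ Subspace λ U → HasRank U i

  module 𝕍 (m i : ℕ) = Spans R {Flat i} {Flat m} (λ (I , _) (K , _) → 𝟙 (I ⊑? K))
  open 𝕍 using (InSpan)

  count : ∀ {U a} → HasRank U a → sum (λ x → 𝟙 (x ∈? U)) ≈ size a · 1#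
  count {U} r with e , e-inj , e∈ , e-surj ← enumerate r = sum-𝟙 (_∈? U) e e-inj e∈ e-surj

  -- The points of `W` split into those inside and those outside `U`. As `a < b`, the truncated
  -- difference of sizes is the true one.
  count-∖ : ∀ {U W a b} → U ⊑ W → HasRank U a → HasRank W b → a < b →
            sum (λ x → 𝟙 (x ∈? W ×-dec ¬? (x ∈? U))) ≈ (size b ∸ size a) · 1#
  count-∖ {U} {W} {a} {b} U⊑W rU rW a<b = ∙-cancelʳ (size a · 1#) _ _ (begin
    sum outer + size a · 1#                     ≈⟨ +-congˡ (count rU) ⟨
    sum outer + sum (λ x → 𝟙 (x ∈? U))          ≈⟨ ∑-distrib-+ outer (λ x → 𝟙 (x ∈? U)) ⟨
    sum (λ x → outer x + 𝟙 (x ∈? U))            ≈⟨ sum-cong-≋ split ⟩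
    sum (λ x → 𝟙 (x ∈? W))                      ≈⟨ count rW ⟩
    size b · 1#                                 ≡⟨ ≡.cong (_· 1#) (ℕ.m∸n+n≡m (ℕ.<⇒≤ (size-mono-< a<b))) ⟨
    (size b ∸ size a ℕ+ size a) · 1#            ≈⟨ ×-homo-+ 1# (size b ∸ size a) (size a) ⟩
    (size b ∸ size a) · 1# + size a · 1#        ∎)
    where
    outer : Fin points → Carrier
    outer x = 𝟙 (x ∈? W ×-dec ¬? (x ∈? U))
    split : ∀ (x : Fin points) → outer x + 𝟙 (x ∈? U) ≈ 𝟙 (x ∈? W)
    split x with x ∈? U
    ... | yes x∈U = trans (+-congʳ (𝟙-no (x ∈? W ×-dec ¬? (yes x∈U)) λ (_ , x∉U) → x∉U x∈U))
                          (trans (+-identityˡ 1#) (sym (𝟙-yes (x ∈? W) (∈-mono U⊑W x∈U))))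
    ... | no x∉U = trans (+-identityʳ _) (𝟙-cong (x ∈? W ×-dec yes x∉U) (x ∈? W) proj₁ (_, x∉U))

  -- Sizes grow strictly with the rank, so the scalar is a positive integer and can be inverted.
  span-unscale : ∀ {m i a b f g} → a < b → InSpan m i f →
                 (∀ K → (size b ∸ size a) · 1# * g K ≈ f K) → InSpan m i g
  span-unscale {m} {i} {a} {b} {f} {g} a<b f∈ p
    with r , rκ≈1 ← ·-invertible (size b ∸ size a) (ℕ.m<n⇒0<n∸m (size-mono-< a<b)) =
    𝕍.span-cong m i (λ K → begin
      g K              ≈⟨ *-identityˡ (g K) ⟨
      1# * g K         ≈⟨ *-congʳ rκ≈1 ⟨
      r * _ * g K      ≈⟨ *-assoc r _ (g K) ⟩
      r * (_ * g K)    ≈⟨ *-congˡ (p K) ⟩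
      r * f K          ∎) (𝕍.span-* m i r f∈)

  private
    -- Serves sums over the points outside a flat: `I ∨ x` is a generator of the next rank only if
    -- `x` is not in `I`, and the factor `𝟙 P?` kills the other terms.
    when : ∀ {m i f} {P : Set} (P? : Dec P) → (P → InSpan m i f) → InSpan m i (λ K → 𝟙 P? * f K)
    when {m} {i} {f} (yes p) f∈ = 𝕍.span-* m i 1# (f∈ p)
    when {m} {i} {f} (no _)  f∈ = 𝕍.span-cong m i (λ K → zeroˡ (f K)) (𝕍.span-0 m i)

  -- If `I ⊑ K`, a point `x` outside `I` lies in `K` exactly when `I ∨ x ⊑ K`. Summing over these
  -- `x` counts the points of `K` outside `I`, a positive number depending only on the ranks.
  raise-χ : ∀ {m a I} → HasRank I a → a < m → InSpan m (suc a) (λ (K , _) → 𝟙 (I ⊑? K))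
  raise-χ {m} {a} {I} rI a<m = span-unscale a<m
    (𝕍.span-sum m (suc a) λ x → when {m} {suc a} (¬? (x ∈? I)) λ x∉I → 𝕍.span-gen m (suc a) (I ∨ x , ∨-rank rI x∉I))
    identity
    where
    identity : ∀ (K : Flat m) → (size m ∸ size a) · 1# * 𝟙 (I ⊑? proj₁ K) ≈
               sum (λ x → 𝟙 (¬? (x ∈? I)) * 𝟙 (I ∨ x ⊑? proj₁ K))
    identity (K , rK) with I ⊑? K
    ... | no I⋢K = trans (zeroʳ _) (sym (sum-zero λ x →
            trans (*-congˡ (𝟙-no (I ∨ x ⊑? K) λ h → I⋢K (⊑-trans (⊑∨ I x) h))) (zeroʳ _)))
    ... | yes I⊑K = trans (*-identityʳ _) (trans (sym (count-∖ I⊑K rI rK a<m)) (sum-cong-≋ term))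
      where
      term : ∀ (x : Fin points) → 𝟙 (x ∈? K ×-dec ¬? (x ∈? I)) ≈ 𝟙 (¬? (x ∈? I)) * 𝟙 (I ∨ x ⊑? K)
      term x with x ∈? I
      ... | yes x∈I = trans (𝟙-no (x ∈? K ×-dec ¬? (yes x∈I)) λ (_ , x∉I) → x∉I x∈I) (sym (zeroˡ _))
      ... | no x∉I  = trans (𝟙-cong (x ∈? K ×-dec yes x∉I) (I ∨ x ⊑? K)
                              (λ (x∈K , _) → ∨-least I⊑K x∈K) (λ h → ∈-mono h (∈∨ I x) , x∉I))
                            (sym (*-identityˡ _))

  raise : ∀ {m a f} → a < m → InSpan m a f → InSpan m (suc a) f
  raise {m} {a} a<m (l , c , I , p) = 𝕍.span-cong m (suc a) p
    (𝕍.span-sum m (suc a) λ j → 𝕍.span-* m (suc a) (c j) (raise-χ (proj₂ (I j)) a<m))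

  ∈-* : ∀ {m a f} x → a < m → InSpan m a f → InSpan m (suc a) (λ (K , r) → 𝟙 (x ∈? K) * f (K , r))
  ∈-* {m} {a} {f} x a<m (l , c , I , p) = 𝕍.span-cong m (suc a)
    (λ (K , r) → begin
      𝟙 (x ∈? K) * f (K , r)                                        ≈⟨ *-congˡ (p (K , r)) ⟩
      𝟙 (x ∈? K) * sum (λ j → c j * 𝟙 (proj₁ (I j) ⊑? K))           ≈⟨ *-distribˡ-sum {l} _ _ ⟩
      sum (λ j → 𝟙 (x ∈? K) * (c j * 𝟙 (proj₁ (I j) ⊑? K)))         ≈⟨ sum-cong-≋ (λ (j : Fin l) → x∙yz≈y∙xz _ _ _) ⟩
      sum (λ j → c j * (𝟙 (x ∈? K) * 𝟙 (proj₁ (I j) ⊑? K)))         ∎)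
    (𝕍.span-sum m (suc a) λ j → 𝕍.span-* m (suc a) (c j) (term (I j)))
    where
    term : ∀ (I : Flat a) → InSpan m (suc a) (λ (K , _) → 𝟙 (x ∈? K) * 𝟙 (proj₁ I ⊑? K))
    term (I , rI) with x ∈? I
    -- Adjoining `x` would not raise the rank here. The point indicator is 1 wherever the generator
    -- of `I` is, so the product is that generator, and `raise-χ` lifts it.
    ... | yes x∈I = 𝕍.span-cong m (suc a) eq (raise-χ rI a<m)
      where
      eq : ∀ (K : Flat m) → 𝟙 (x ∈? proj₁ K) * 𝟙 (I ⊑? proj₁ K) ≈ 𝟙 (I ⊑? proj₁ K)
      eq (K , _) with I ⊑? K
      ... | yes I⊑K = trans (*-identityʳ _) (𝟙-yes (x ∈? K) (∈-mono I⊑K x∈I))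
      ... | no _    = zeroʳ _
    ... | no x∉I = 𝕍.span-cong m (suc a) eq (𝕍.span-gen m (suc a) (I ∨ x , ∨-rank rI x∉I))
      where
      eq : ∀ (K : Flat m) → 𝟙 (x ∈? proj₁ K) * 𝟙 (I ⊑? proj₁ K) ≈ 𝟙 (I ∨ x ⊑? proj₁ K)
      eq (K , _) with x ∈? K
      ... | yes x∈K = trans (*-identityˡ _) (𝟙-cong (I ⊑? K) (I ∨ x ⊑? K)
                        (λ h → ∨-least h x∈K) (⊑-trans (⊑∨ I x)))
      ... | no x∉K  = trans (zeroˡ _) (sym (𝟙-no (I ∨ x ⊑? K) λ h → x∉K (∈-mono h (∈∨ I x))))

  -- Indicators of the flats below a fixed flat.

  same-rank : ∀ {U W a} → HasRank U a → HasRank W a → U ⊑ W → W ⊑ U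
  same-rank {U} {W} rU rW U⊑W with W ⊑? U
  ... | yes W⊑U = W⊑U
  ... | no W⋢U  = ⊥-elim (ℕ.<-irrefl refl (rank-< rU rW U⊑W W⋢U))

  -- Take `w` in `K` outside `J`. Then `J ∨ w` is contained in `J′` and has the same rank, so it
  -- equals `J′`, and modularity gives `K = (K ∩ J) ∨ w`. Hence `K ∩ J` has rank exactly one less
  -- than `K`.
  ∩-rank : ∀ {K J J′ m b} → HasRank K (suc m) → HasRank J b → HasRank J′ (suc b) →
           J ⊑ J′ → K ⊑ J′ → ¬ K ⊑ J → HasRank (K ∩ J) m
  ∩-rank {K} {J} {J′} {m} rK rJ rJ′ J⊑J′ K⊑J′ K⋢J
    with w , w∈K , w∉J ← separate K⋢J
    with u , rU ← hasRank (K ∩ J) = ≡.subst (HasRank (K ∩ J)) (ℕ.suc-injective (rank-unique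
      (rank-cong (∨-least (∩⊑ˡ K J) w∈K) K⊑ (∨-rank rU (w∉J ∘ ∈-mono (∩⊑ʳ K J)))) rK)) rU
    where
    J′⊑ : J′ ⊑ J ∨ w
    J′⊑ = same-rank (∨-rank rJ w∉J) rJ′ (∨-least J⊑J′ (∈-mono K⊑J′ w∈K))
    K⊑ : K ⊑ K ∩ J ∨ w
    K⊑ with K ⊑? K ∩ J ∨ w
    ... | yes h = h
    ... | no ¬h with x , x∈K , x∉ ← separate ¬h =
      ⊥-elim (x∉ (modular w∈K x∈K (∈-mono J′⊑ (∈-mono K⊑J′ x∈K))))

  -- Induction on the corank `i` of `J`, passing to a flat `J′` that covers it. The bound `i ≤ m` is
  -- what permits `raise` and `∈-*` at each step.
  below : ∀ {m i b J} → HasRank J b → b ℕ+ i ≡ n → i ≤ m → InSpan m i (λ (K , _) → 𝟙 (K ⊑? J))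
  -- A flat of corank 0 contains every `K`, so the indicator is constantly 1, as is the generator of
  -- the bottom flat.
  below {m} {zero} {b} {J} rJ b+0≡n _
    with B , rB , B⊑ ← bottom | T , rT , ⊑T ← top =
    𝕍.span-cong m 0
      (λ (K , _) → 𝟙-cong (K ⊑? J) (B ⊑? K) (λ _ → B⊑ K)
        (λ _ → ⊑-trans (⊑T K) (same-rank (≡.subst (HasRank J) (≡.trans (≡.sym (ℕ.+-identityʳ b)) b+0≡n) rJ) rT (⊑T J))))
      (𝕍.span-gen m 0 (B , rB))
  below {suc m} {suc i} {b} {J} rJ b+i≡n 1+i≤m
    with T , rT , ⊑T ← top
    -- Positive corank means `b < n`, so the top is not below `J` and a cover exists.
    with J′ , rJ′ , J⊑J′ , _ ← extend rJ (⊑T J) (λ T⊑J → ℕ.<⇒≱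
           (≡.subst (b <_) (≡.trans (≡.sym (ℕ.+-suc b i)) b+i≡n) (s≤s (ℕ.m≤m+n b i))) (rank-mono rT rJ T⊑J)) =
    span-unscale (ℕ.n<1+n m)
      (𝕍.span-+ (suc m) (suc i) (𝕍.span-* (suc m) (suc i) κ (raise 1+i≤m below-J′))
        (𝕍.span-* (suc m) (suc i) (- 1#) (𝕍.span-sum (suc m) (suc i) λ x →
          when {suc m} {suc i} (¬? (x ∈? J)) λ _ → ∈-* x 1+i≤m below-J′)))
      identity
    where
    κ : Carrier
    -- The number of points of `K` outside `J` whenever `K ⊑ J′` but not `K ⊑ J`, because `K ∩ J`
    -- then has rank `m`.
    κ = (size (suc m) ∸ size m) · 1#
    below-J′ : InSpan (suc m) i (λ (K , _) → 𝟙 (K ⊑? J′))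
    below-J′ = below rJ′ (≡.trans (≡.sym (ℕ.+-suc b i)) b+i≡n) (ℕ.≤-trans (ℕ.n≤1+n i) 1+i≤m)
    identity : ∀ (K : Flat (suc m)) → κ * 𝟙 (proj₁ K ⊑? J) ≈ κ * 𝟙 (proj₁ K ⊑? J′) +
               - 1# * sum (λ x → 𝟙 (¬? (x ∈? J)) * (𝟙 (x ∈? proj₁ K) * 𝟙 (proj₁ K ⊑? J′)))
    identity (K , rK) = trans (x≈z//y _ _ _ (balance (K ⊑? J′) (K ⊑? J))) (+-congˡ (sym (-1*x≈-x _)))
      where
      outer : Dec (K ⊑ J′) → Carrier
      outer d = sum (λ x → 𝟙 (¬? (x ∈? J)) * (𝟙 (x ∈? K) * 𝟙 d))
      -- The subtracted sum is moved to the left. If `K` is not below `J′`, all terms vanish; if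
      -- `K ⊑ J`, no point of `K` is outside `J`; otherwise the sum counts the points of `K` outside
      -- `K ∩ J`.
      balance : (d : Dec (K ⊑ J′)) (d′ : Dec (K ⊑ J)) → κ * 𝟙 d′ + outer d ≈ κ * 𝟙 d
      balance (no K⋢J′) d′ = begin
        κ * 𝟙 d′ + outer (no K⋢J′)   ≈⟨ +-cong (*-congˡ (𝟙-no d′ λ K⊑J → K⋢J′ (⊑-trans K⊑J J⊑J′)))
                                                 (sum-zero λ (x : Fin points) → trans (*-congˡ (zeroʳ _)) (zeroʳ _)) ⟩
        κ * 0# + 0#                  ≈⟨ +-identityʳ _ ⟩
        κ * 0#                       ∎
      balance (yes _) (yes K⊑J) = trans (+-congˡ (sum-zero vanish)) (+-identityʳ _)
        where
        vanish : ∀ (x : Fin points) → 𝟙 (¬? (x ∈? J)) * (𝟙 (x ∈? K) * 1#) ≈ 0#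
        vanish x with x ∈? J
        ... | yes _  = zeroˡ _
        ... | no x∉J = trans (*-congˡ (trans (*-congʳ (𝟙-no (x ∈? K) (x∉J ∘ ∈-mono K⊑J))) (zeroˡ _))) (zeroʳ _)
      balance (yes K⊑J′) (no K⋢J) = begin
        κ * 0# + outer (yes K⊑J′)                               ≈⟨ +-congʳ (zeroʳ κ) ⟩
        0# + outer (yes K⊑J′)                                   ≈⟨ +-identityˡ _ ⟩
        outer (yes K⊑J′)                                        ≈⟨ sum-cong-≋ term ⟩
        sum (λ x → 𝟙 (x ∈? K ×-dec ¬? (x ∈? K ∩ J)))            ≈⟨ count-∖ (∩⊑ˡ K J) (∩-rank rK rJ rJ′ J⊑J′ K⊑J′ K⋢J)
                                                                      rK (ℕ.n<1+n m) ⟩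
        κ                                                       ≈⟨ *-identityʳ κ ⟨
        κ * 1#                                                  ∎
        where
        term : ∀ (x : Fin points) → 𝟙 (¬? (x ∈? J)) * (𝟙 (x ∈? K) * 1#) ≈ 𝟙 (x ∈? K ×-dec ¬? (x ∈? K ∩ J))
        term x with x ∈? J
        ... | yes x∈J = trans (zeroˡ _) (sym (𝟙-no (x ∈? K ×-dec ¬? (x ∈? K ∩ J))
                          λ (x∈K , x∉) → x∉ (∈∩ x∈K x∈J)))
        ... | no x∉J  = trans (*-identityˡ _) (trans (*-identityʳ _)
                          (𝟙-cong (x ∈? K) (x ∈? K ×-dec ¬? (x ∈? K ∩ J))
                            (λ x∈K → x∈K , x∉J ∘ ∈-mono (∩⊑ʳ K J)) proj₁))

  -- Pullback of spans along an order reversal.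

  -- Composing with `φ` turns the generator of `U` into the indicator of `W ⊑ ψ U`, and `ψ U` has
  -- corank `i`, so `below` applies. With `φ` and `ψ` separate, the result serves both the
  -- anti-automorphism and its inverse.
  span-dual : ∀ {k m i f} (φ : Flat m → Flat k) (ψ : Subspace → Subspace) →
              (∀ U W → U ⊑ proj₁ (φ W) ⇔ proj₁ W ⊑ ψ U) →
              (∀ {U} → HasRank U i → ∃ λ b → HasRank (ψ U) b × b ℕ+ i ≡ n) →
              i ≤ m → InSpan k i f → InSpan m i (f ∘ φ)
  span-dual {m = m} {i} φ ψ galois corank i≤m (l , c , I , p) = 𝕍.span-cong m i (p ∘ φ)
    (𝕍.span-sum m i λ j → 𝕍.span-* m i (c j) (χ∘φ∈ (I j)))
    where
    χ∘φ∈ : ∀ (U : Flat i) → InSpan m i (λ W → 𝟙 (proj₁ U ⊑? proj₁ (φ W)))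
    χ∘φ∈ (U , rU) with b , rψU , b+i≡n ← corank rU = 𝕍.span-cong m i
      (λ W → let open Equivalence (galois U W) in 𝟙-cong (U ⊑? proj₁ (φ W)) (proj₁ W ⊑? ψ U) to from)
      (below rψU b+i≡n i≤m)

-- Division by positive integers in the reals.

-- A multiple of `1ᴿ` is a constant sequence, so the constant sequence at the rational inverse works
-- termwise.
ℝ-·-invertible : Indicators.PositivesInvertible ℝ-commutativeRing
ℝ-·-invertible (suc d) _ = fromℚ (ℚ.1/ (suc d ·ℚ ℚ.1ℚ)) , ≗⇒≈ᴿ λ k →
  ≡.trans (≡.cong (ℚ.1/ (suc d ·ℚ ℚ.1ℚ) ℚ.*_) (seq-· k (suc d))) (ℚ.*-inverseˡ (suc d ·ℚ ℚ.1ℚ))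
  where
  open Algebra.Properties.Monoid.Mult ℚ.+-0-monoid renaming (_×_ to _·ℚ_)
  open Indicators ℝ-commutativeRing using (_·_)
  seq-· : ∀ k d → seq (d · 1ᴿ) k ≡ d ·ℚ ℚ.1ℚ
  seq-· k zero    = refl
  seq-· k (suc d) = ≡.cong (ℚ.1ℚ ℚ.+_) (seq-· k d)
  nonNegative : ∀ d → ℚ.0ℚ ℚ.≤ d ·ℚ ℚ.1ℚ
  nonNegative zero    = ℚ.≤-refl
  nonNegative (suc d) = ℚ.+-mono-≤ (ℚ.<⇒≤ (ℚ.positive⁻¹ ℚ.1ℚ)) (nonNegative d)
  instance
    nonZero : ℚ.NonZero (suc d ·ℚ ℚ.1ℚ)
    nonZero = ℚ.pos⇒nonZero (suc d ·ℚ ℚ.1ℚ) {{ℚ.positive (ℚ.+-mono-<-≤ (ℚ.positive⁻¹ ℚ.1ℚ) (nonNegative d))}}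

-- Dualization preserves spans and degrees.

module Duality {n} {L : RankedLattice n} (P : PointStructure L) (A : RankedLattice.AntiAutomorphism L) where
  open RankedLattice L renaming (_≤_ to _⊑_; _≤?_ to _⊑?_; ≤-trans to ⊑-trans) hiding (_≈_)
  open AntiAutomorphism A
  open Indicators ℝ-commutativeRing using (𝟙; sum-cong-≋)
  open CommutativeRing ℝ-commutativeRing using (sym; trans) renaming (refl to ≈-refl)

  V̄-cong : ∀ {m i} {f g : Fun L m} → _≈ᶠ_ L g f → V̄ L m i f → V̄ L m i g
  V̄-cong g≈f (l , c , I , p) = l , c , I , λ K → trans (g≈f K) (p K)

  -- Carries `span-dual` over to `V̄`. The function `g` is given separately because a `Fun` must
  -- respect equality, which `φ` alone does not guarantee for the composite.
  V̄-pullback : ∀ {k m i} (φ : Setoid.Carrier (subspaces L m) → Setoid.Carrier (subspaces L k)) (ψ : Subspace → Subspace) →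
               (∀ U W → U ⊑ proj₁ (φ W) ⇔ proj₁ W ⊑ ψ U) →
               (∀ {U} → HasRank U i → ∃ λ b → HasRank (ψ U) b × b ℕ+ i ≡ n) →
               i ≤ m → (f : Fun L k) (g : Fun L m) → (∀ W → Func.to g W ≈ᴿ Func.to f (φ W)) → V̄ L k i f → V̄ L m i g
  V̄-pullback {k} {m} φ ψ galois corank i≤m f g g≈fφ (l , c , I , p) =
    let l′ , c′ , I′ , p′ = Degrees.span-dual ℝ-commutativeRing ℝ-·-invertible P {f = Func.to f} φ ψ galois corank i≤m
          (l , c , I , λ K → trans (p K) (sum-cong-≋ {l} λ j →
            *ᴿ-cong {c j} {c j} {Func.to (χ L (proj₁ (I j)) k) K} {𝟙 (proj₁ (I j) ⊑? proj₁ K)}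
              ≈-refl (χ≈𝟙 (proj₁ (I j)) K)))
    in l′ , c′ , I′ , λ W → trans (g≈fφ W) (trans (p′ W) (sym (sum-cong-≋ {l′} λ j →
         *ᴿ-cong {c′ j} {c′ j} {Func.to (χ L (proj₁ (I′ j)) m) W} {𝟙 (proj₁ (I′ j) ⊑? proj₁ W)}
           ≈-refl (χ≈𝟙 (proj₁ (I′ j)) W))))
    where
    -- Definitional, but left to the conversion checker inside a product of reals it takes long, since the
    -- two products are then compared as unfolded Cauchy sequences.
    χ≈𝟙 : ∀ {r} U (K : Setoid.Carrier (subspaces L r)) → Func.to (χ L U r) K ≈ᴿ 𝟙 (U ⊑? proj₁ K)
    χ≈𝟙 U K = ≈-refl

  ⊥-rank : ∀ {U k} → HasRank U k → HasRank (U ^⊥) (n ∸ k)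
  ⊥-rank {U} {k} r with c , rc ← hasRank (U ^⊥) =
    ≡.subst (HasRank (U ^⊥)) (≡.trans (≡.sym (ℕ.m+n∸n≡m c k)) (≡.cong (_∸ k) (rank-⊥ r rc))) rc

  -- The inverse of `dual`. Dualizing twice would not do, since an anti-automorphism need not be an
  -- involution.
  undual : ∀ {k} → Fun L (n ∸ k) → Fun L k
  undual g = record
    { to   = λ (K , r) → Func.to g (K ^⊥ , ⊥-rank r)
    ; cong = λ (p , q) → Func.cong g (mono q , mono p)
    }

  dual-undual : ∀ {k} (k≤n : k ≤ n) g → _≈ᶠ_ L g (dual L A k≤n (undual g))
  dual-undual k≤n g (W , _) = let p , q = ⊥⁻¹-⊥ W in Func.cong g (q , p)

  module _ {k} (k≤n : k ≤ n) where

    -- The value at `K` is recovered by evaluating the dual at `K ^⊥`.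
    dual-cancel : ∀ {f g} → _≈ᶠ_ L (dual L A k≤n f) (dual L A k≤n g) → _≈ᶠ_ L f g
    dual-cancel {f} {g} h (K , r) =
      trans (sym (dual-⊥ L A k≤n f K r (⊥-rank r))) (trans (h (K ^⊥ , ⊥-rank r)) (dual-⊥ L A k≤n g K r (⊥-rank r)))

    -- Rests on the equivalence of `U ⊑ W ^⊥⁻¹` and `W ⊑ U ^⊥`. The new flats have rank `n ∸ k`,
    -- whence the bound on `i`.
    dual-V̄ : ∀ f {i} → i ≤ n ∸ k → V̄ L k i f → V̄ L (n ∸ k) i (dual L A k≤n f)
    dual-V̄ f i≤ = V̄-pullback (λ (W , r) → W ^⊥⁻¹ , rank-⊥⁻¹ k≤n r) _^⊥
      (λ U (W , _) → let p , q = ⊥⁻¹-⊥ W in mk⇔ (λ h → ⊑-trans q (mono h)) (λ h → cancel (⊑-trans p h)))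
      (λ {U} rU → let c , rc = hasRank (U ^⊥) in c , rc , rank-⊥ rU rc)
      i≤ f (dual L A k≤n f) (λ W → ≈-refl)

    undual-V̄ : ∀ g {i} → i ≤ k → V̄ L (n ∸ k) i g → V̄ L k i (undual g)
    undual-V̄ g i≤ = V̄-pullback (λ (K , r) → K ^⊥ , ⊥-rank r) _^⊥⁻¹
      (λ U (K , _) → let p , q = ⊥⁻¹-⊥ U in mk⇔ (λ h → cancel (⊑-trans p h)) (λ h → ⊑-trans q (mono h)))
      (λ {U} rU → let c , rc = hasRank (U ^⊥⁻¹) ; p , q = ⊥⁻¹-⊥ U in
        c , rc , ≡.trans (ℕ.+-comm c _) (rank-⊥ rc (rank-cong q p rU)))
      i≤ g (undual g) (λ K → ≈-refl)

    -- The functions `f` and `undual (dual f)` have the same dual, hence agree. This direction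
    -- transfers the minimality of the degree.
    dual-V̄⁻¹ : ∀ f {i} → i ≤ k → V̄ L (n ∸ k) i (dual L A k≤n f) → V̄ L k i f
    dual-V̄⁻¹ f {i} i≤ h = V̄-cong {f = undual (dual L A k≤n f)} {f}
      (dual-cancel {f} {undual (dual L A k≤n f)} (dual-undual k≤n (dual L A k≤n f)))
      (undual-V̄ (dual L A k≤n f) i≤ h)

    -- The bound by the minimum serves both inclusions: `i ≤ n ∸ k` to dualize and `i ≤ k` to go
    -- back.
    dualSet-V̄ : ∀ i → i ≤ k ⊓ (n ∸ k) → dualSet L A k≤n (V̄ L k i) ≐ V̄ L (n ∸ k) i
    dualSet-V̄ i i≤ =
      (λ {g} (f , f∈ , g≈) → V̄-cong {f = dual L A k≤n f} {g} g≈ (dual-V̄ f (ℕ.≤-trans i≤ (ℕ.m⊓n≤n k (n ∸ k))) f∈)) ,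
      (λ {g} g∈ → undual g , undual-V̄ g (ℕ.≤-trans i≤ (ℕ.m⊓n≤m k (n ∸ k))) g∈ , dual-undual k≤n g)

    dual-degree : ∀ f d → HasDegree L f d ⇔ HasDegree L (dual L A k≤n f) d
    dual-degree f ⊥₋ = mk⇔ (λ h (W , r) → h (W ^⊥⁻¹ , rank-⊥⁻¹ k≤n r)) (dual-cancel {f} {𝟎 L})
    dual-degree f [ t ] = mk⇔
      (λ (f≉0 , t≤ , f∈ , least) →
        f≉0 ∘ dual-cancel {f} {𝟎 L} ,
        to≤ t≤ ,
        dual-V̄ f (ℕ.≤-trans t≤ (ℕ.m⊓n≤n k (n ∸ k))) f∈ ,
        λ s s≤ f∈ → least s (from≤ s≤) (dual-V̄⁻¹ f (ℕ.≤-trans (from≤ s≤) (ℕ.m⊓n≤m k (n ∸ k))) f∈))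
      (λ (f≉0 , t≤ , f∈ , least) →
        (λ f≈0 → f≉0 λ (W , r) → f≈0 (W ^⊥⁻¹ , rank-⊥⁻¹ k≤n r)) ,
        from≤ t≤ ,
        dual-V̄⁻¹ f (ℕ.≤-trans (from≤ t≤) (ℕ.m⊓n≤m k (n ∸ k))) f∈ ,
        λ s s≤ f∈ → least s (to≤ s≤) (dual-V̄ f (ℕ.≤-trans s≤ (ℕ.m⊓n≤n k (n ∸ k))) f∈))
      where
      -- The admissible degrees on both sides have the same bound, as `n ∸ (n ∸ k)` is `k`.
      range : (n ∸ k) ⊓ (n ∸ (n ∸ k)) ≡ k ⊓ (n ∸ k)
      range = ≡.trans (≡.cong ((n ∸ k) ⊓_) (ℕ.m∸[m∸n]≡n k≤n)) (ℕ.⊓-comm (n ∸ k) k)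
      to≤ : ∀ {s} → s ≤ k ⊓ (n ∸ k) → s ≤ (n ∸ k) ⊓ (n ∸ (n ∸ k))
      to≤ {s} = ≡.subst (s ≤_) (≡.sym range)
      from≤ : ∀ {s} → s ≤ (n ∸ k) ⊓ (n ∸ (n ∸ k)) → s ≤ k ⊓ (n ∸ k)
      from≤ {s} = ≡.subst (s ≤_) range

-- The point structure of a finite set.

module _ {A : Set} {n} (A-finite : Fin n ↔ A) where
  open Subsets A-finite
  open Inverse A-finite using () renaming (to to elem; from to index; strictlyInverseˡ to elem-index)

  private
    at-index : ∀ (U : Subset) {x} → T (U x) → T (U (elem (index x)))
    at-index U {x} = ≡.subst (T ∘ U) (≡.sym (elem-index x))

    insert-∈ : ∀ x U → T (insert x U x)
    insert-∈ x U with x ≟ x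
    ... | yes _  = _
    ... | no x≢x = ⊥-elim (x≢x refl)

    insert-⊆ : ∀ x U W → U ⊆ W → T (W x) → insert x U ⊆ W
    insert-⊆ x U W U⊆W x∈W y p with x ≟ y
    ... | yes refl = x∈W
    ... | no _     = U⊆W y p

    ⊆-insert : ∀ x U → U ⊆ insert x U
    ⊆-insert x U y p = Equivalence.from T-∨ (inj₂ p)

  elementStructure : PointStructure subsetLattice
  elementStructure = record
    { points      = n
    ; _∈_         = λ x U → T (U (elem x))
    ; _∈?_        = λ x U → T? (U (elem x))
    ; ∈-mono      = λ {_} {_} {x} U⊆W → U⊆W (elem x)
    ; separate    = λ {U} {W} U⊈W → let x , x∈U , x∉W = witness U⊈W in
        index x , at-index U x∈U , x∉W ∘ ≡.subst (T ∘ W) (elem-index x)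
    ; _∨_         = λ U x → insert (elem x) U
    ; ⊑∨          = λ U x → ⊆-insert (elem x) U
    ; ∈∨          = λ U x → insert-∈ (elem x) U
    ; ∨-least     = λ {U} {W} {x} → insert-⊆ (elem x) U W
    ; ∨-rank      = insert-size
    ; _∩_         = λ U W x → U x ∧ W x
    ; ∩⊑ˡ         = λ U W x p → proj₁ (Equivalence.to T-∧ p)
    ; ∩⊑ʳ         = λ U W x p → proj₂ (Equivalence.to (T-∧ {U x}) p)
    ; ∈∩          = λ p q → Equivalence.from T-∧ (p , q)
    -- Either `x` is `w` itself, or it lies in `W` and hence in `U ∩ W`.
    ; modular     = λ {U} {W} {w} {x} _ x∈U x∈ → Equivalence.from T-∨
        (map₂ (λ x∈W → Equivalence.from T-∧ (x∈U , x∈W)) (Equivalence.to T-∨ x∈))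
    ; size        = λ a → a
    ; size-mono-< = λ a<b → a<b
    ; enumerate   = λ {U} r → let open Inverse r using (from; strictlyInverseˡ) renaming (to to nth) in
        (λ t → index (proj₁ (nth t))) ,
        (λ {s} {t} p → enum-injective r (index-injective p)) ,
        (λ t → at-index U (proj₂ (nth t))) ,
        λ {x} x∈U → from (elem x , x∈U) ,
          ≡.trans (≡.cong (index ∘ proj₁) (strictlyInverseˡ (elem x , x∈U))) (Inverse.strictlyInverseʳ A-finite x)
    }

-- The point structure of a vector space.

module _ {q} (F : FiniteField q) (V : Module (FiniteField.commutativeRing F) 0ℓ 0ℓ) where
  open FiniteField F using (commutativeRing)
  open CommutativeRing commutativeRing using (1#; 0#; -_)
  open Module V
  open Subspaces F V
  open LinearSubspace using (mem; ∈-resp; 0∈; +∈; *∈)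
  open Relation.Binary.Reasoning.Setoid ≈ᴹ-setoid

  intersection : LinearSubspace → LinearSubspace → LinearSubspace
  intersection U W = record
    { mem    = λ v → mem U v ∧ mem W v
    ; ∈-resp = λ u≈v u∈ → let p , r = Equivalence.to T-∧ u∈ in Equivalence.from T-∧ (∈-resp U u≈v p , ∈-resp W u≈v r)
    ; 0∈     = Equivalence.from T-∧ (0∈ U , 0∈ W)
    ; +∈     = λ u∈ v∈ → let p , r = Equivalence.to T-∧ u∈ ; s , t = Equivalence.to T-∧ v∈ in
                 Equivalence.from T-∧ (+∈ U p s , +∈ W r t)
    ; *∈     = λ a v∈ → let p , r = Equivalence.to T-∧ v∈ in Equivalence.from T-∧ (*∈ U a p , *∈ W a r)
    }

  summand-∈ : ∀ U {u v w} → u ∈ U → v ∈ U → u +ᴹ w ≈ᴹ v → w ∈ U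
  summand-∈ U {u} {v} {w} u∈U v∈U u+w≈v = ∈-resp U (begin
    (- 1#) *ₗ u +ᴹ v           ≈⟨ +ᴹ-congˡ u+w≈v ⟨
    (- 1#) *ₗ u +ᴹ (u +ᴹ w)    ≈⟨ +ᴹ-assoc _ u w ⟨
    (- 1#) *ₗ u +ᴹ u +ᴹ w      ≈⟨ +ᴹ-congʳ (≈ᴹ-trans (+ᴹ-comm _ u) (cancel u)) ⟩
    0ᴹ +ᴹ w                    ≈⟨ +ᴹ-identityˡ w ⟩
    w                          ∎) (+∈ U (*∈ U (- 1#) u∈U) v∈U)

  module _ {n} (V-dim : HasDim whole n) where
    private
      L : RankedLattice n
      L = subspaceLattice V-dim

      dimension : ∀ U → ∃ (HasDim U)
      dimension = RankedLattice.hasRank L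

      basis : ∀ U → HasDim U (proj₁ (dimension U))
      basis U = proj₂ (dimension U)

      point : Fin (q ^ n) → Carrierᴹ
      point = vec V-dim

    -- The sum of `U` and the multiples of `v`. If `v ∈ U` the spanning family is dependent, but its
    -- span is still the right one.
    adjoin : LinearSubspace → Carrierᴹ → LinearSubspace
    adjoin U v = span V-dim (v ◂ proj₁ (basis U))

    ⊆-adjoin : ∀ U v → U ⊆ adjoin U v
    ⊆-adjoin U v u u∈U = let b , B = basis U ; c , p = Equivalence.to (IsBasis.spans B u) u∈U in
      to-span V-dim (v ◂ b)
        ( (λ { zero → 0# ; (suc j) → c j })
        , ≈ᴹ-trans (+ᴹ-congʳ (*ₗ-zeroˡ v)) (≈ᴹ-trans (+ᴹ-identityˡ (lincomb c b)) p))

    ∈-adjoin : ∀ U v → v ∈ adjoin U v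
    ∈-adjoin U v = let b , B = basis U in
      to-span V-dim (v ◂ b)
        ( (λ { zero → 1# ; (suc j) → 0# })
        , ≈ᴹ-trans (+ᴹ-cong (*ₗ-identityˡ v) (lincomb-0 b)) (+ᴹ-identityʳ v))

    ∈-adjoin⁻ : ∀ U v {u} → u ∈ adjoin U v → ∃₂ λ a w → w ∈ U × a *ₗ v +ᴹ w ≈ᴹ u
    ∈-adjoin⁻ U v u∈ = let b , B = basis U ; c , p = from-span V-dim (v ◂ b) u∈ in
      c zero , lincomb (c ∘ suc) b , lincomb-∈ U (c ∘ suc) b (basis-∈ {U} B) , p

    adjoin-⊆ : ∀ U W {v} → U ⊆ W → v ∈ W → adjoin U v ⊆ W
    adjoin-⊆ U W {v} U⊆W v∈W = let b , B = basis U in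
      span-⊆ V-dim (v ◂ b) W λ { zero → v∈W ; (suc j) → U⊆W (b j) (basis-∈ {U} B j) }

    adjoin-dim : ∀ U {v a} → HasDim U a → ¬ v ∈ U → HasDim (adjoin U v) (suc a)
    adjoin-dim U {v} r v∉U = let b , B = basis U in
      -- The basis chosen in `adjoin` has the length found by `hasRank`, which uniqueness of rank
      -- identifies with `a`.
      ≡.subst (λ d → HasDim (adjoin U v) (suc d)) (RankedLattice.rank-unique L {U} (proj₂ (dimension U)) r)
        (v ◂ b , span-basis V-dim (v ◂ b) (◂-independent {U} (IsBasis.independent B) (basis-∈ {U} B) v∉U))

    -- Write `v` as a multiple of `w` plus some `y ∈ W`. Since `v` and that multiple lie in `U`, so
    -- does their difference `y`.
    adjoin-modular : ∀ U W {w v} → w ∈ U → v ∈ U → v ∈ adjoin W w → v ∈ adjoin (intersection U W) w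
    adjoin-modular U W {w} {v} w∈U v∈U v∈ =
      let a , y , y∈W , p = ∈-adjoin⁻ W w v∈
          I = intersection U W
          y∈I = Equivalence.from T-∧ (summand-∈ U (*∈ U a w∈U) v∈U p , y∈W)
      in ∈-resp (adjoin I w) p (+∈ (adjoin I w) (*∈ (adjoin I w) a (∈-adjoin I w)) (⊆-adjoin I w y y∈I))

    point-injective : ∀ {i j} → point i ≈ᴹ point j → i ≡ j
    point-injective {i} {j} p =
      decode-injective n (unique-coefficients (IsBasis.independent (proj₂ V-dim)) (decode n i) (decode n j) p)

    -- Coordinates in a basis of `U` number its vectors by `Fin (q ^ a)`; independence gives
    -- injectivity and spanning gives surjectivity.
    enumerate-flat : ∀ {U a} → HasDim U a → ∃ λ (e : Fin (q ^ a) → Fin (q ^ n)) →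
                     Injective _≡_ _≡_ e × (∀ t → point (e t) ∈ U) × (∀ {x} → point x ∈ U → ∃ λ t → e t ≡ x)
    enumerate-flat {U} {a} (b , B) = nth , nth-injective , nth∈ , nth-surjective
      where
      nth : Fin (q ^ a) → Fin (q ^ n)
      nth t = proj₁ (vec-surjective V-dim (lincomb (decode a t) b))
      point-nth : ∀ t → point (nth t) ≈ᴹ lincomb (decode a t) b
      point-nth t = proj₂ (vec-surjective V-dim (lincomb (decode a t) b))
      nth-injective : Injective _≡_ _≡_ nth
      nth-injective {s} {t} p = decode-injective a (unique-coefficients (IsBasis.independent B) (decode a s) (decode a t)
        (≈ᴹ-trans (≈ᴹ-sym (point-nth s)) (≡.subst (λ x → point x ≈ᴹ _) (≡.sym p) (point-nth t))))
      nth∈ : ∀ t → point (nth t) ∈ U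
      nth∈ t = ∈-resp U (≈ᴹ-sym (point-nth t)) (lincomb-∈ U (decode a t) b (basis-∈ {U} B))
      nth-surjective : ∀ {x} → point x ∈ U → ∃ λ t → nth t ≡ x
      nth-surjective {x} x∈U = let c , p = Equivalence.to (IsBasis.spans B (point x)) x∈U in
        encode c , point-injective (≈ᴹ-trans (point-nth (encode c)) (≈ᴹ-trans (lincomb-cong (decode-encode c)) p))

    vectorStructure : PointStructure (subspaceLattice V-dim)
    vectorStructure = record
      { points      = q ^ n
      ; _∈_         = λ x U → point x ∈ U
      ; _∈?_        = λ x U → T? (mem U (point x))
      ; ∈-mono      = λ {_} {_} {x} U⊆W → U⊆W (point x)
      ; separate    = λ {U} {W} → separate-flats U W
      ; _∨_         = λ U x → adjoin U (point x)
      ; ⊑∨          = λ U x → ⊆-adjoin U (point x)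
      ; ∈∨          = λ U x → ∈-adjoin U (point x)
      ; ∨-least     = λ {U} {W} → adjoin-⊆ U W
      ; ∨-rank      = λ {U} → adjoin-dim U
      ; _∩_         = intersection
      ; ∩⊑ˡ         = λ U W v p → proj₁ (Equivalence.to T-∧ p)
      ; ∩⊑ʳ         = λ U W v p → proj₂ (Equivalence.to (T-∧ {mem U v}) p)
      ; ∈∩          = λ p r → Equivalence.from T-∧ (p , r)
      ; modular     = λ {U} {W} → adjoin-modular U W
      ; size        = q ^_
      ; size-mono-< = ℕ.^-monoʳ-< q 1<q
      ; enumerate   = λ {U} → enumerate-flat {U}
      }
      where
      separate-flats : ∀ U W → ¬ U ⊆ W → ∃ λ x → point x ∈ U × ¬ point x ∈ W
      separate-flats U W U⊈W =
        let v , v∈U , v∉W = witness V-dim {U} {W} U⊈W ; x , p = vec-surjective V-dim v in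
        x , ∈-resp U (≈ᴹ-sym p) v∈U , v∉W ∘ ∈-resp W p

-- Sets and vector spaces together.

pointStructure : ∀ {n} (V : Space n) → PointStructure (lattice V)
pointStructure (finiteSet V V-finite)  = elementStructure V-finite
pointStructure (vectorSpace F V V-dim) = vectorStructure F V V-dim

theorem5p3 : ∀ {n} (V : Space n) (A : RankedLattice.AntiAutomorphism (lattice V)) {k} (k≤n : k ≤ n) →
    (∀ i → i ≤ k ⊓ (n ∸ k) →
    dualSet (lattice V) A k≤n (V̄ (lattice V) k i) ≐ V̄ (lattice V) (n ∸ k) i)
    × (∀ (f : Fun (lattice V) k) (d : ℕ ₋) →
    HasDegree (lattice V) f d ⇔ HasDegree (lattice V) (dual (lattice V) A k≤n f) d)
theorem5p3 V A k≤n = dualSet-V̄ k≤n , dual-degree k≤n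
  where open Duality (pointStructure V) A
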